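{- Let $\psi\colon\mathbb{N}\to(0,1]$ be a decreasing function, let $N\ge 1$ be an integer, and let $\sigma\in\mathcal{L}_{up}^*(\psi,N)$. Suppose there is a differentiable, non-negative function $\vartheta\colon\mathbb{R}^+\to\mathbb{R}$ with non-constant derivative $\vartheta'$ such that (i) $\vartheta'$ is increasing for $x\ge 1$, (ii) $e\,\psi(x)\,\vartheta(x)\le\vartheta'(x)$ for all $x\in\mathbb{N}$ with $x\ge N$, and (iii) $\vartheta'(1)\ge 1$. Then, as $n\to\infty$, $$\mathbb{E}(H_{n,\sigma})\le \bigl(\ln\vartheta'(n)\bigr)\,(1+o(1)).$$
   Context: $\mathbb{N}=\{1,2,3,\dots\}$; $\mathbb{R}^+$ is the set of positive reals; $\ln$ is the natural logarithm and $e$ is Euler's number. "Increasing" and "decreasing" are meant in the non-strict sense. Binary trees: $\mathcal{T}$ is the set of full binary trees, i.e. rooted ordered trees in which each node has either exactly two children (a left and a right one) or none. The size $|t|$ of $t\in\mathcal{T}$ is its number of leaves, and $\mathcal{T}_n$ is the set of $t\in\mathcal{T}$ with $|t|=n$. For $|t|\ge 2$, $t_\ell$ and $t_r$ denote the left and right subtrees at the root. The height is $h(t)=0$ if $|t|=1$ and $h(t)=1+\max(h(t_\ell),h(t_r))$ otherwise. Leaf-centric tree sources: $\mathcal{L}$ is the set of all functions $\sigma\colon\mathbb{N}\times\mathbb{N}\to[0,1]$ with $\sum_{i=1}^{k-1}\sigma(i,k-i)=1$ for every integer $k\ge 2$. For $\sigma\in\mathcal{L}$ define $P_\sigma\colon\mathcal{T}\to[0,1]$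 by $P_\sigma(t)=1$ if $|t|=1$ and $P_\sigma(t)=\sigma(|t_\ell|,|t_r|)\cdot P_\sigma(t_\ell)\cdot P_\sigma(t_r)$ otherwise. For every $n\ge1$, $P_\sigma$ restricted to $\mathcal{T}_n$ is a probability mass function. $H_{n,\sigma}$ denotes the height of a random tree drawn from $\mathcal{T}_n$ according to $P_\sigma$, so $\mathbb{E}(H_{n,\sigma})=\sum_{t\in\mathcal{T}_n}P_\sigma(t)h(t)$. Upper-bounded sources: $\mathcal{L}_{up}^*(\psi,N)$ is the set of all $\sigma\in\mathcal{L}$ such that $\sigma(i,n-i)+\sigma(n-i,i)\le\psi(n)$ for all integers $n\ge N$ and $1\le i\le n-1$. An inequality $a_n\le b_n(1+o(1))$ means that there is a real sequence $\varepsilon_n\to0$ with $a_n\le b_n(1+\varepsilon_n)$ for all sufficiently large $n$ (with $\sigma,\psi,N,\vartheta$ fixed). -}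

module Defs where

open import Algebra.Bundles using (CommutativeRing)
import Algebra.Construct.NaturalChoice.Max as Max
import Algebra.Properties.Ring as RingProperties
import Algebra.Properties.Semiring.Exp as Exp
import Algebra.Properties.Semiring.Mult as Mult
open import Axiom.ExcludedMiddle using (ExcludedMiddle)
open import Data.List.Base
  using (List; []; _∷_; [_]; map; foldr; upTo; applyUpTo; concatMap; cartesianProductWith)
open import Data.List.Membership.Propositional using (_∈_; find; lose)
open import Data.List.Membership.Propositional.Properties
  using (∈-concatMap⁺; ∈-concatMap⁻; ∈-cartesianProductWith⁺; ∈-cartesianProductWith⁻; ∈-upTo⁺)
import Data.List.Relation.Unary.All as All
open import Data.List.Relation.Unary.All.Properties using () renaming (map⁺ to All-map⁺)
import Data.List.Relation.Unary.AllPairs as AllPairs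
open import Data.List.Relation.Unary.AllPairs.Properties using () renaming (map⁺ to AllPairs-map⁺)
open import Data.List.Relation.Unary.Any using (here; there)
open import Data.List.Relation.Unary.Unique.Propositional using (Unique)
open import Data.List.Relation.Unary.Unique.Propositional.Properties
  using (concat⁺; cartesianProductWith⁺; upTo⁺)
open import Data.Nat.Base as ℕ using (ℕ; zero; suc; NonZero; z≤n; s≤s)
import Data.Nat.Properties as ℕ
open import Data.Product using (Σ; ∃; _×_; _,_; proj₁; proj₂)
open import Data.Sum.Base using (inj₁; inj₂)
open import Function.Base using (_∘_; case_of_)
open import Function.Bundles using (Func)
open import Level using (0ℓ) renaming (suc to lsuc)
open import Relation.Binary.Bundles using (Setoid; TotalOrder)
open import Relation.Binary.Core using (Rel)
open import Relation.Binary.Structures using (IsTotalOrder)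
import Relation.Binary.Construct.NonStrictToStrict as ToStrict
import Relation.Binary.Construct.On as On
open import Relation.Binary.PropositionalEquality as ≡ using (_≡_; refl)
open import Relation.Nullary using (¬_; yes; no)
open import Relation.Unary using (Pred; Satisfiable)

------------------------------------------------------------------------
-- Full binary trees

data Tree : Set where
  leaf : Tree
  node : (l r : Tree) → Tree

size : Tree → ℕ
size leaf       = 1
size (node l r) = size l ℕ.+ size r

height : Tree → ℕ
height leaf       = 0
height (node l r) = suc (height l ℕ.⊔ height r)

-- `enum f n` lists the trees of size n once f ≥ n; the fuel f is only there
-- to make the recursion structural.

enum : ℕ → ℕ → List Tree
enum zero    _             = []
enum (suc f) zero          = []
enum (suc f) (suc zero)    = [ leaf ]
enum (suc f) (suc (suc m)) =
  concatMap (λ i → cartesianProductWith node (enum f (suc i)) (enum f (suc m ℕ.∸ i)))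
            (upTo (suc m))

-- The finite set 𝒯ₙ, as a list without repetitions; the lemmas below check
-- that it consists of exactly the trees of size n.

𝒯 : ℕ → List Tree
𝒯 n = enum n n

size>0 : ∀ t → 0 ℕ.< size t
size>0 leaf       = s≤s z≤n
size>0 (node l r) = ℕ.≤-trans (size>0 l) (ℕ.m≤m+n (size l) (size r))

private
  upTo-bound : ∀ {i} n → i ∈ upTo n → i ℕ.< n
  upTo-bound n i∈ = go n (λ k → k) (λ k<n → k<n) i∈
    where
    go : ∀ {i b} m (g : ℕ → ℕ) → (∀ {k} → k ℕ.< m → g k ℕ.< b) →
         i ∈ applyUpTo g m → i ℕ.< b
    go (suc m) g g< (here refl) = g< (s≤s z≤n)
    go (suc m) g g< (there i∈)  = go m (g ∘ suc) (g< ∘ s≤s) i∈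

enum-sound : ∀ f n {t} → t ∈ enum f n → size t ≡ n
enum-sound (suc f) (suc zero)    (here refl) = refl
enum-sound (suc f) (suc (suc m)) t∈
  with i , i∈ , t∈ᵢ ← find (∈-concatMap⁻ _ {xs = upTo (suc m)} t∈)
  with _ , _ , l∈ , r∈ , refl ← ∈-cartesianProductWith⁻ node (enum f (suc i)) _ t∈ᵢ
  rewrite enum-sound f _ l∈ | enum-sound f _ r∈
  = ≡.cong suc (ℕ.m+[n∸m]≡n (ℕ.<⇒≤ (upTo-bound (suc m) i∈)))

enum-complete : ∀ f t → size t ℕ.≤ f → t ∈ enum f (size t)
enum-complete (suc f) leaf       _  = here refl
enum-complete zero    leaf       ()
enum-complete zero    (node l r) le
  with () ← ℕ.≤-trans (size>0 (node l r)) le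
enum-complete (suc f) (node l r) le = go (size l) (size r) refl refl le
  where
  go : ∀ a b → size l ≡ a → size r ≡ b → a ℕ.+ b ℕ.≤ suc f →
       node l r ∈ enum (suc f) (a ℕ.+ b)
  go zero b p _ _ with () ← ≡.subst (0 ℕ.<_) p (size>0 l)
  go (suc a) zero _ q _ with () ← ≡.subst (0 ℕ.<_) q (size>0 r)
  go (suc a) (suc b) p q (s≤s le′) rewrite ℕ.+-suc a b =
    ∈-concatMap⁺ _ (lose (∈-upTo⁺ (s≤s (ℕ.m≤m+n a b)))
      (∈-cartesianProductWith⁺ node
        (≡.subst (λ k → l ∈ enum f k) p
          (enum-complete f l (≡.subst (ℕ._≤ f) (≡.sym p) (ℕ.≤-trans (s≤s (ℕ.m≤m+n a b)) le′))))
        (≡.subst (λ k → r ∈ enum f k) (≡.trans q (≡.sym eq))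
          (enum-complete f r (≡.subst (ℕ._≤ f) (≡.sym q) (ℕ.≤-trans (s≤s (ℕ.m≤n+m b a)) le′))))))
    where
    eq : suc (a ℕ.+ b) ℕ.∸ a ≡ suc b
    eq = ≡.trans (≡.cong (ℕ._∸ a) (≡.sym (ℕ.+-suc a b))) (ℕ.m+n∸m≡n a (suc b))

enum-unique : ∀ f n → Unique (enum f n)
enum-unique zero    _             = AllPairs.[]
enum-unique (suc f) zero          = AllPairs.[]
enum-unique (suc f) (suc zero)    = All.[] AllPairs.∷ AllPairs.[]
enum-unique (suc f) (suc (suc m)) = concat⁺
  (All-map⁺ (All.tabulate λ {i} _ →
    cartesianProductWith⁺ node (λ { refl → refl , refl })
      (enum-unique f (suc i)) (enum-unique f (suc m ℕ.∸ i))))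
  (AllPairs-map⁺ (AllPairs.map disjoint (upTo⁺ (suc m))))
  where
  disjoint : ∀ {i j} → ¬ i ≡ j → ∀ {t} →
    ¬ (t ∈ cartesianProductWith node (enum f (suc i)) (enum f (suc m ℕ.∸ i)) ×
       t ∈ cartesianProductWith node (enum f (suc j)) (enum f (suc m ℕ.∸ j)))
  disjoint {i} {j} i≢j (t∈ᵢ , t∈ⱼ)
    with _ , _ , l∈ , _ , refl ← ∈-cartesianProductWith⁻ node (enum f (suc i)) _ t∈ᵢ
    with _ , _ , l∈′ , _ , refl ← ∈-cartesianProductWith⁻ node (enum f (suc j)) _ t∈ⱼ
    = i≢j (ℕ.suc-injective (≡.trans (≡.sym (enum-sound f _ l∈)) (enum-sound f _ l∈′)))

𝒯-sound : ∀ n {t} → t ∈ 𝒯 n → size t ≡ n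
𝒯-sound n = enum-sound n n

𝒯-complete : ∀ t → t ∈ 𝒯 (size t)
𝒯-complete t = enum-complete (size t) t ℕ.≤-refl

𝒯-unique : ∀ n → Unique (𝒯 n)
𝒯-unique n = enum-unique n n

------------------------------------------------------------------------
-- The real numbers
--
-- The library has no real numbers.  They are given by the usual
-- second-order axioms of a Dedekind-complete ordered field, which determine
-- them up to isomorphism.

record CompleteOrderedField : Set (lsuc 0ℓ) where
  infix 4 _≤_
  infix 8 _⁻¹
  field
    commutativeRing : CommutativeRing 0ℓ 0ℓ

  open CommutativeRing commutativeRing public

  field
    0≉1          : ¬ 0# ≈ 1#
    -- Total, with an unspecified value at 0#.
    _⁻¹          : Carrier → Carrier
    *-inverseʳ   : ∀ x → ¬ x ≈ 0# → x * x ⁻¹ ≈ 1#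
    _≤_          : Rel Carrier 0ℓ
    isTotalOrder : IsTotalOrder _≈_ _≤_
    +-monoˡ-≤    : ∀ z {x y} → x ≤ y → x + z ≤ y + z
    *-nonNeg     : ∀ {x y} → 0# ≤ x → 0# ≤ y → 0# ≤ x * y

  UpperBound : Pred Carrier 0ℓ → Pred Carrier 0ℓ
  UpperBound S b = ∀ x → S x → x ≤ b

  field
    supremum : (S : Pred Carrier 0ℓ) → Satisfiable S → Satisfiable (UpperBound S) →
               ∃ λ s → UpperBound S s × (∀ b → UpperBound S b → s ≤ b)

  totalOrder : TotalOrder 0ℓ 0ℓ 0ℓ
  totalOrder = record { isTotalOrder = isTotalOrder }

  module ≤ = IsTotalOrder isTotalOrder

  open ToStrict _≈_ _≤_ public using (_<_)
  open Max totalOrder public using (_⊔_)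
  open Exp semiring public using (_^_)
  open Mult semiring public using () renaming (_×_ to _·_)

  ∣_∣ : Carrier → Carrier
  ∣ x ∣ = x ⊔ - x

  fromℕ : ℕ → Carrier
  fromℕ n = n · 1#

  Σ[_] : List Carrier → Carrier
  Σ[_] = foldr _+_ 0#

  0≤1 : 0# ≤ 1#
  0≤1 with ≤.total 0# 1#
  ... | inj₁ 0≤1 = 0≤1
  ... | inj₂ 1≤0 = ≤.trans (*-nonNeg 0≤-1 0≤-1)
                     (≤.reflexive (trans (-1*x≈-x (- 1#)) (-‿involutive 1#)))
    where
    open RingProperties ring using (-1*x≈-x; -‿involutive)
    0≤-1 : 0# ≤ - 1#
    0≤-1 = ≤.trans (≤.reflexive (sym (-‿inverseʳ 1#)))
             (≤.trans (+-monoˡ-≤ (- 1#) 1≤0) (≤.reflexive (+-identityˡ (- 1#))))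

  x≤1+x : ∀ x → x ≤ 1# + x
  x≤1+x x = ≤.trans (≤.reflexive (sym (+-identityˡ x))) (+-monoˡ-≤ x 0≤1)

  1≤fromℕ-suc : ∀ n → 1# ≤ fromℕ (suc n)
  1≤fromℕ-suc zero    = ≤.reflexive (sym (+-identityʳ 1#))
  1≤fromℕ-suc (suc n) = ≤.trans (1≤fromℕ-suc n) (x≤1+x (fromℕ (suc n)))

  0<fromℕ-suc : ∀ n → 0# < fromℕ (suc n)
  0<fromℕ-suc n = ≤.trans 0≤1 (1≤fromℕ-suc n) ,
    λ 0≈n → 0≉1 (≤.antisym 0≤1 (≤.trans (1≤fromℕ-suc n) (≤.reflexive (sym 0≈n))))

  ℝ⁺ : Setoid 0ℓ 0ℓ
  ℝ⁺ = On.setoid {B = Σ Carrier (0# <_)} setoid proj₁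

  Pos : Set
  Pos = Setoid.Carrier ℝ⁺

  value : Pos → Carrier
  value = proj₁

  fromℕ⁺ : (n : ℕ) .{{_ : NonZero n}} → Pos
  fromℕ⁺ (suc n) = fromℕ (suc n) , 0<fromℕ-suc n

  1⁺ : Pos
  1⁺ = 1# , 0≤1 , 0≉1

  infix 4 _⟶_
  _⟶_ : (ℕ → Carrier) → Carrier → Set
  s ⟶ l = ∀ ε → 0# < ε → ∃ λ n₀ → ∀ n → n₀ ℕ.≤ n → ∣ s n - l ∣ < ε

  -- ϑ′ is the derivative of ϑ on ℝ⁺: the difference quotient
  -- (ϑ x - ϑ a) / (x - a) tends to ϑ′ a as x → a, x ≠ a.
  IsDerivative : (ϑ ϑ′ : Func ℝ⁺ setoid) → Set
  IsDerivative ϑ ϑ′ = ∀ a ε → 0# < ε → ∃ λ δ → 0# < δ × (∀ x →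
    ¬ value x ≈ value a → ∣ value x - value a ∣ < δ →
    ∣ (to ϑ x - to ϑ a) * (value x - value a) ⁻¹ - to ϑ′ a ∣ < ε)
    where open Func

  Constant : Func ℝ⁺ setoid → Set
  Constant f = ∃ λ c → ∀ x → Func.to f x ≈ c

------------------------------------------------------------------------
-- Exponential and logarithm

-- Excluded middle turns limits and inverse functions into total functions,
-- with the value 0# where the limit or the preimage does not exist.

module Transcendental (lem : ExcludedMiddle 0ℓ) (ℝ : CompleteOrderedField) where
  open CompleteOrderedField ℝ

  lim : (ℕ → Carrier) → Carrier
  lim s = case lem {∃ λ l → s ⟶ l} of λ where
    (yes (l , _)) → l
    (no _)        → 0#

  -- eˣ = lim (1 + x/n)ⁿ
  exp : Carrier → Carrier
  exp x = lim λ n → (1# + x * fromℕ (suc n) ⁻¹) ^ suc n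

  e : Carrier
  e = exp 1#

  -- The inverse of exp; 0# outside the range ℝ⁺ of exp.
  ln : Carrier → Carrier
  ln x = case lem {∃ λ y → exp y ≈ x} of λ where
    (yes (y , _)) → y
    (no _)        → 0#

------------------------------------------------------------------------
-- Leaf-centric binary tree sources
--
-- The positive integers are the nonzero elements of ℕ; a function on them is
-- a function on ℕ whose values at 0 are neither constrained nor used.

module Sources (ℝ : CompleteOrderedField) where
  open CompleteOrderedField ℝ

  record IsSource (σ : ℕ → ℕ → Carrier) : Set where
    field
      nonNeg : ∀ i j .{{_ : NonZero i}} .{{_ : NonZero j}} → 0# ≤ σ i j
      ≤1     : ∀ i j .{{_ : NonZero i}} .{{_ : NonZero j}} → σ i j ≤ 1#
      -- applyUpTo suc (k ∸ 1) = 1 ∷ 2 ∷ … ∷ k ∸ 1 ∷ []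
      total  : ∀ k → 2 ℕ.≤ k →
               Σ[ map (λ i → σ i (k ℕ.∸ i)) (applyUpTo suc (k ℕ.∸ 1)) ] ≈ 1#

  record IsUpperBoundedSource (ψ : ℕ → Carrier) (N : ℕ) (σ : ℕ → ℕ → Carrier) : Set where
    field
      isSource : IsSource σ
      bounded  : ∀ n i → N ℕ.≤ n → 1 ℕ.≤ i → i ℕ.< n →
                 σ i (n ℕ.∸ i) + σ (n ℕ.∸ i) i ≤ ψ n

  P : (ℕ → ℕ → Carrier) → Tree → Carrier
  P σ leaf       = 1#
  P σ (node l r) = σ (size l) (size r) * P σ l * P σ r

  𝔼[H_,_] : ℕ → (ℕ → ℕ → Carrier) → Carrier
  𝔼[H n , σ ] = Σ[ map (λ t → P σ t * fromℕ (height t)) (𝒯 n) ]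

-- aₙ ≤ bₙ (1 + o(1)) as n → ∞, for sequences indexed by the positive integers
module Asymptotics (ℝ : CompleteOrderedField) where
  open CompleteOrderedField ℝ

  infix 4 _≤_[1+o1]
  _≤_[1+o1] : (a b : (n : ℕ) .{{_ : NonZero n}} → Carrier) → Set
  a ≤ b [1+o1] = ∃ λ ε → ε ⟶ 0# × ∃ λ n₀ → ∀ n .{{_ : NonZero n}} → n₀ ℕ.≤ n →
    a n ≤ b n * (1# + ε n)

{-# OPTIONS --safe #-}

-- Put gₙ = E(e^Hₙ).  Since e^(1 + max(h, k)) ≤ e (e^h + e^k), splitting at the
-- root gives gₙ ≤ e ψ(n) Σ_{i<n} gᵢ for n ≥ N.  Hence gₙ ≤ e^N ϑ′(n) by induction:
-- Σ_{i<n} ϑ′(i) ≤ ϑ(n) by the mean value theorem, as ϑ′ is increasing, and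
-- e ψ(n) ϑ(n) ≤ ϑ′(n).  By Jensen's inequality E(Hₙ) ≤ ln ϑ′(n) + O(1).
--
-- The constant is o(ln ϑ′(n)) because ϑ′ is unbounded: summing the bound on σ
-- over i gives (n - 1) ψ(n) ≥ 2, so ϑ′(n) ≥ 2e ϑ(n) / (n - 1), and ϑ(2m) ≥ m ϑ′(m)
-- then yields ϑ′(2m) ≥ 2 ϑ′(m).

module Submission where

open import Algebra.Bundles using (CommutativeRing)
import Algebra.Construct.NaturalChoice.Max as Max
import Algebra.Properties.CommutativeSemigroup as CommutativeSemigroupProperties
import Algebra.Properties.CommutativeSemiring.Exp as Exp
import Algebra.Properties.Ring as RingProperties
import Algebra.Properties.Semiring.Mult as Mult
import Algebra.Properties.Semiring.Mult.TCOptimised as TCMult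
import Algebra.Solver.Ring
open import Algebra.Solver.Ring.AlmostCommutativeRing
  using (AlmostCommutativeRing; _-Raw-AlmostCommutative⟶_)
open import Axiom.ExcludedMiddle using (ExcludedMiddle)
open import Data.Integer.Base as ℤ using (ℤ; +_; -[1+_])
import Data.Integer.Properties as ℤ
open import Data.List.Base
  using (List; []; _∷_; map; _++_; upTo; applyUpTo; concatMap; cartesianProductWith)
open import Data.List.Membership.Propositional using (_∈_)
open import Data.List.Properties using (map-upTo; map-∘; map-applyUpTo)
open import Data.List.Relation.Unary.Any using (here; there)
open import Data.Maybe.Base using (Maybe; just; nothing)
open import Data.Nat.Base as ℕ using (ℕ; zero; suc; NonZero; z≤n; s≤s)
import Data.Nat.Properties as ℕ
open import Data.Product using (∃; _×_; _,_; proj₁; proj₂)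
open import Data.Sign.Base as Sign using (Sign)
open import Data.Sum.Base using (_⊎_; inj₁; inj₂)
open import Function.Base using (_∘_)
open import Function.Bundles using (Func)
open import Level using (0ℓ)
open import Relation.Binary.Bundles using (TotalOrder)
import Relation.Binary.Construct.NonStrictToStrict as ToStrict
open import Relation.Binary.PropositionalEquality as ≡ using (_≡_)
import Relation.Binary.Reasoning.PartialOrder as PartialOrderReasoning
import Relation.Binary.Reasoning.Setoid as SetoidReasoning
open import Relation.Nullary using (¬_; yes; no)
open import Relation.Nullary.Negation using (contradiction)
open import Defs

-- Hypothesis (ii) is scaled so that a bound C ϑ′(n) on the moments reproduces itself with the same
-- C. Hence C is fixed by the sizes below N, where ψ says nothing about σ and only the trivial bound
-- of the height by the size is available; this is the origin of e^N. The harder side is analytic.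
-- `exp` is a limit with a default value and `ln` an unspecified preimage, so neither a functional
-- equation nor continuity nor injectivity comes for free. One-sided estimates of the terms (1 +
-- x/n)^n replace them, and values are compared with integer powers e^k only. Jensen's inequality
-- therefore takes a discrete form: if e^k < y ≤ e^(k+1), every natural h satisfies h ≤ k + e^h /
-- e^(k+1), and averaging this needs nothing but the moment bound and k ≤ ln y. Likewise the mean
-- value theorem enters only as a lower bound for increments, which a supremum argument gives
-- without any continuity of the derivative.

-- Integer coefficients make cancellation visible to the solver, which cannot
-- decide equality in an abstract ring.
module IntegerSolver {c ℓ} (R : CommutativeRing c ℓ) where
  open CommutativeRing R
  open RingProperties ring
  open TCMult semiring using (×-homo-+; ×1-homo-*) renaming (_×_ to _×′_)
  open SetoidReasoning setoid

  almostCommutativeRing : AlmostCommutativeRing c ℓ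
  almostCommutativeRing = record
    { isAlmostCommutativeRing = record
      { isCommutativeSemiring = isCommutativeSemiring
      ; -‿cong                = -‿cong
      ; -‿*-distribˡ          = λ x y → sym (-‿distribˡ-* x y)
      ; -‿+-comm              = -‿+-comm
      }
    }

  ⟦_⟧ℕ : ℕ → Carrier
  ⟦ n ⟧ℕ = n ×′ 1#

  ⟦_⟧ℤ : ℤ → Carrier
  ⟦ + n      ⟧ℤ = ⟦ n ⟧ℕ
  ⟦ -[1+ n ] ⟧ℤ = - ⟦ suc n ⟧ℕ

  ⟦_⟧± : Sign → Carrier
  ⟦ Sign.+ ⟧± = 1#
  ⟦ Sign.- ⟧± = - 1#

  ⟦-⟧-homo : ∀ i → ⟦ ℤ.- i ⟧ℤ ≈ - ⟦ i ⟧ℤ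
  ⟦-⟧-homo (+ zero)  = sym -0#≈0#
  ⟦-⟧-homo (+ suc n) = refl
  ⟦-⟧-homo -[1+ n ]  = sym (-‿involutive _)

  ⟦∸⟧-homo : ∀ {m n} → n ℕ.≤ m → ⟦ m ℕ.∸ n ⟧ℕ ≈ ⟦ m ⟧ℕ - ⟦ n ⟧ℕ
  ⟦∸⟧-homo {m} {n} n≤m = begin
    ⟦ m ℕ.∸ n ⟧ℕ                       ≈⟨ +-identityʳ _ ⟨
    ⟦ m ℕ.∸ n ⟧ℕ + 0#                  ≈⟨ +-congˡ (-‿inverseʳ _) ⟨
    ⟦ m ℕ.∸ n ⟧ℕ + (⟦ n ⟧ℕ - ⟦ n ⟧ℕ)   ≈⟨ +-assoc _ _ _ ⟨
    ⟦ m ℕ.∸ n ⟧ℕ + ⟦ n ⟧ℕ - ⟦ n ⟧ℕ     ≈⟨ +-congʳ (×-homo-+ 1# (m ℕ.∸ n) n) ⟨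
    ⟦ m ℕ.∸ n ℕ.+ n ⟧ℕ - ⟦ n ⟧ℕ        ≡⟨ ≡.cong (λ k → ⟦ k ⟧ℕ - ⟦ n ⟧ℕ) (ℕ.m∸n+n≡m n≤m) ⟩
    ⟦ m ⟧ℕ - ⟦ n ⟧ℕ                    ∎

  ⟦⊖⟧-homo : ∀ m n → ⟦ m ℤ.⊖ n ⟧ℤ ≈ ⟦ m ⟧ℕ - ⟦ n ⟧ℕ
  ⟦⊖⟧-homo m n with ℕ.≤-total n m
  ... | inj₁ n≤m rewrite ℤ.⊖-≥ n≤m = ⟦∸⟧-homo n≤m
  ... | inj₂ m≤n rewrite ℤ.⊖-≤ m≤n = begin
    ⟦ ℤ.- (+ (n ℕ.∸ m)) ⟧ℤ  ≈⟨ ⟦-⟧-homo (+ (n ℕ.∸ m)) ⟩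
    - ⟦ n ℕ.∸ m ⟧ℕ          ≈⟨ -‿cong (⟦∸⟧-homo m≤n) ⟩
    - (⟦ n ⟧ℕ - ⟦ m ⟧ℕ)     ≈⟨ ⁻¹-anti-homo‿- ⟦ n ⟧ℕ ⟦ m ⟧ℕ ⟩
    ⟦ m ⟧ℕ - ⟦ n ⟧ℕ         ∎

  ⟦+⟧-homo : ∀ i j → ⟦ i ℤ.+ j ⟧ℤ ≈ ⟦ i ⟧ℤ + ⟦ j ⟧ℤ
  ⟦+⟧-homo (+ m)    (+ n)    = ×-homo-+ 1# m n
  ⟦+⟧-homo (+ m)    -[1+ n ] = ⟦⊖⟧-homo m (suc n)
  ⟦+⟧-homo -[1+ m ] (+ n)    = trans (⟦⊖⟧-homo n (suc m)) (+-comm _ _)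
  ⟦+⟧-homo -[1+ m ] -[1+ n ] = begin
    - ⟦ suc (suc (m ℕ.+ n)) ⟧ℕ     ≡⟨ ≡.cong (λ k → - ⟦ suc k ⟧ℕ) (ℕ.+-suc m n) ⟨
    - ⟦ suc m ℕ.+ suc n ⟧ℕ         ≈⟨ -‿cong (×-homo-+ 1# (suc m) (suc n)) ⟩
    - (⟦ suc m ⟧ℕ + ⟦ suc n ⟧ℕ)    ≈⟨ -‿+-comm _ _ ⟨
    - ⟦ suc m ⟧ℕ - ⟦ suc n ⟧ℕ      ∎

  ⟦◃⟧-homo : ∀ s n → ⟦ s ℤ.◃ n ⟧ℤ ≈ ⟦ s ⟧± * ⟦ n ⟧ℕ
  ⟦◃⟧-homo s      zero    = sym (zeroʳ ⟦ s ⟧±)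
  ⟦◃⟧-homo Sign.+ (suc n) = sym (*-identityˡ _)
  ⟦◃⟧-homo Sign.- (suc n) = sym (-1*x≈-x _)

  ⟦±⟧-homo : ∀ s t → ⟦ s Sign.* t ⟧± ≈ ⟦ s ⟧± * ⟦ t ⟧±
  ⟦±⟧-homo Sign.+ t      = sym (*-identityˡ _)
  ⟦±⟧-homo Sign.- Sign.+ = sym (*-identityʳ _)
  ⟦±⟧-homo Sign.- Sign.- = sym (trans (-1*x≈-x _) (-‿involutive 1#))

  ⟦*⟧-homo : ∀ i j → ⟦ i ℤ.* j ⟧ℤ ≈ ⟦ i ⟧ℤ * ⟦ j ⟧ℤ
  ⟦*⟧-homo i j = begin
    ⟦ s Sign.* t ℤ.◃ m ℕ.* n ⟧ℤ              ≈⟨ ⟦◃⟧-homo (s Sign.* t) (m ℕ.* n) ⟩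
    ⟦ s Sign.* t ⟧± * ⟦ m ℕ.* n ⟧ℕ           ≈⟨ *-cong (⟦±⟧-homo s t) (×1-homo-* m n) ⟩
    ⟦ s ⟧± * ⟦ t ⟧± * (⟦ m ⟧ℕ * ⟦ n ⟧ℕ)      ≈⟨ medial _ _ _ _ ⟩
    ⟦ s ⟧± * ⟦ m ⟧ℕ * (⟦ t ⟧± * ⟦ n ⟧ℕ)      ≈⟨ *-cong (⟦◃⟧-homo s m) (⟦◃⟧-homo t n) ⟨
    ⟦ s ℤ.◃ m ⟧ℤ * ⟦ t ℤ.◃ n ⟧ℤ              ≡⟨ ≡.cong₂ (λ a b → ⟦ a ⟧ℤ * ⟦ b ⟧ℤ)
                                                 (ℤ.signᵢ◃∣i∣≡i i) (ℤ.signᵢ◃∣i∣≡i j) ⟩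
    ⟦ i ⟧ℤ * ⟦ j ⟧ℤ                          ∎
    where
    open CommutativeSemigroupProperties *-commutativeSemigroup using () renaming (interchange to medial)
    s = ℤ.sign i
    t = ℤ.sign j
    m = ℤ.∣ i ∣
    n = ℤ.∣ j ∣

  morphism : ℤ.+-*-rawRing -Raw-AlmostCommutative⟶ almostCommutativeRing
  morphism = record
    { ⟦_⟧    = ⟦_⟧ℤ
    ; +-homo = ⟦+⟧-homo
    ; *-homo = ⟦*⟧-homo
    ; -‿homo = ⟦-⟧-homo
    ; 0-homo = refl
    ; 1-homo = refl
    }

  coefficient≟ : ∀ i j → Maybe (⟦ i ⟧ℤ ≈ ⟦ j ⟧ℤ)
  coefficient≟ i j with i ℤ.≟ j
  ... | yes ≡.refl = just refl
  ... | no  _      = nothing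

  open Algebra.Solver.Ring ℤ.+-*-rawRing almostCommutativeRing morphism coefficient≟ public
    using (solve; _:=_; _:+_; _:*_; _:-_; :-_; _:^_; con; Polynomial)

  𝟙 : ∀ {n} → Polynomial n
  𝟙 = con (+ 1)

-- Order arithmetic, powers and the Archimedean property.

module OrderedField (ℝ : CompleteOrderedField) where
  open CompleteOrderedField ℝ
  open IntegerSolver commutativeRing
  open Mult semiring using (×-homo-+)
  open Max totalOrder using (⊔-sel; x≤x⊔y; x≤y⊔x)

  module ≤-Reasoning = PartialOrderReasoning (TotalOrder.poset totalOrder)
  open ≤-Reasoning

  <⇒≱ : ∀ {x y} → x < y → ¬ y ≤ x
  <⇒≱ = ToStrict.<⇒≱ _≈_ _≤_ ≤.antisym

  ≰⇒> : ∀ {x y} → ¬ x ≤ y → y < x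
  ≰⇒> = ToStrict.≰⇒> _≈_ _≤_ sym ≤.reflexive ≤.total

  <⇒≉ : ∀ {x y} → x < y → ¬ y ≈ x
  <⇒≉ (_ , x≉y) = x≉y ∘ sym

  +-mono-≤ : ∀ {u v x y} → u ≤ v → x ≤ y → u + x ≤ v + y
  +-mono-≤ {u} {v} {x} {y} u≤v x≤y = begin
    u + x  ≤⟨ +-monoˡ-≤ x u≤v ⟩
    v + x  ≈⟨ +-comm v x ⟩
    x + v  ≤⟨ +-monoˡ-≤ v x≤y ⟩
    y + v  ≈⟨ +-comm y v ⟩
    v + y  ∎

  +-monoʳ-≤ : ∀ z {x y} → x ≤ y → z + x ≤ z + y
  +-monoʳ-≤ z = +-mono-≤ (≤.refl {z})

  +-nonNeg : ∀ {x y} → 0# ≤ x → 0# ≤ y → 0# ≤ x + y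
  +-nonNeg 0≤x 0≤y = ≤.trans (≤.reflexive (sym (+-identityˡ 0#))) (+-mono-≤ 0≤x 0≤y)

  x≤y⇒0≤y-x : ∀ {x y} → x ≤ y → 0# ≤ y - x
  x≤y⇒0≤y-x {x} {y} x≤y = begin
    0#     ≈⟨ -‿inverseʳ x ⟨
    x - x  ≤⟨ +-monoˡ-≤ (- x) x≤y ⟩
    y - x  ∎

  ≤-gap : ∀ {x y d} → 0# ≤ d → y ≈ x + d → x ≤ y
  ≤-gap {x} {y} {d} 0≤d y≈x+d = begin
    x       ≈⟨ +-identityʳ x ⟨
    x + 0#  ≤⟨ +-monoʳ-≤ x 0≤d ⟩
    x + d   ≈⟨ y≈x+d ⟨
    y       ∎

  0≤y-x⇒x≤y : ∀ {x y} → 0# ≤ y - x → x ≤ y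
  0≤y-x⇒x≤y {x} {y} 0≤d = ≤-gap 0≤d (solve 2 (λ x y → y := x :+ (y :- x)) refl x y)

  x<y⇒0<y-x : ∀ {x y} → x < y → 0# < y - x
  x<y⇒0<y-x {x} {y} (x≤y , x≉y) = x≤y⇒0≤y-x x≤y , λ 0≈y-x → x≉y (begin-equality
    x            ≈⟨ +-identityʳ x ⟨
    x + 0#       ≈⟨ +-congˡ 0≈y-x ⟩
    x + (y - x)  ≈⟨ solve 2 (λ x y → x :+ (y :- x) := y) refl x y ⟩
    y            ∎)

  0<y-x⇒x<y : ∀ {x y} → 0# < y - x → x < y
  0<y-x⇒x<y {x} {y} (0≤d , 0≉d) =
    0≤y-x⇒x≤y 0≤d , λ x≈y → 0≉d (sym (trans (+-congˡ (-‿cong x≈y)) (-‿inverseʳ y)))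

  x≤y+z⇒x-z≤y : ∀ {x y z} → x ≤ y + z → x - z ≤ y
  x≤y+z⇒x-z≤y {x} {y} {z} x≤ = ≤-gap (x≤y⇒0≤y-x x≤)
    (solve 3 (λ x y z → y := x :- z :+ (y :+ z :- x)) refl x y z)

  x≤z-y⇒x+y≤z : ∀ {x y z} → x ≤ z - y → x + y ≤ z
  x≤z-y⇒x+y≤z {x} {y} {z} x≤ = ≤-gap (x≤y⇒0≤y-x x≤)
    (solve 3 (λ x y z → z := x :+ y :+ (z :- y :- x)) refl x y z)

  *-monoˡ-≤ : ∀ {z x y} → 0# ≤ z → x ≤ y → z * x ≤ z * y
  *-monoˡ-≤ {z} {x} {y} 0≤z x≤y = ≤-gap (*-nonNeg 0≤z (x≤y⇒0≤y-x x≤y))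
    (solve 3 (λ x y z → z :* y := z :* x :+ z :* (y :- x)) refl x y z)

  *-monoʳ-≤ : ∀ {z x y} → 0# ≤ z → x ≤ y → x * z ≤ y * z
  *-monoʳ-≤ {z} {x} {y} 0≤z x≤y = ≤-gap (*-nonNeg (x≤y⇒0≤y-x x≤y) 0≤z)
    (solve 3 (λ x y z → y :* z := x :* z :+ (y :- x) :* z) refl x y z)

  *-mono-≤ : ∀ {u v x y} → 0# ≤ u → 0# ≤ y → u ≤ v → x ≤ y → u * x ≤ v * y
  *-mono-≤ 0≤u 0≤y u≤v x≤y = ≤.trans (*-monoˡ-≤ 0≤u x≤y) (*-monoʳ-≤ 0≤y u≤v)

  square-nonNeg : ∀ x → 0# ≤ x * x
  square-nonNeg x with ≤.total 0# x
  ... | inj₁ 0≤x = *-nonNeg 0≤x 0≤x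
  ... | inj₂ x≤0 = begin
    0#                     ≤⟨ *-nonNeg (x≤y⇒0≤y-x x≤0) (x≤y⇒0≤y-x x≤0) ⟩
    (0# - x) * (0# - x)    ≈⟨ solve 1 (λ x → (con (+ 0) :- x) :* (con (+ 0) :- x) := x :* x) refl x ⟩
    x * x                  ∎

  0<1 : 0# < 1#
  0<1 = 0≤1 , 0≉1

  <-≤-trans : ∀ {x y z} → x < y → y ≤ z → x < z
  <-≤-trans {x} {y} {z} x<y y≤z = begin-strict x <⟨ x<y ⟩ y ≤⟨ y≤z ⟩ z ∎

  ≤-<-trans : ∀ {x y z} → x ≤ y → y < z → x < z
  ≤-<-trans {x} {y} {z} x≤y y<z = begin-strict x ≤⟨ x≤y ⟩ y <⟨ y<z ⟩ z ∎

  x<1+x : ∀ {x} → x < 1# + x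
  x<1+x {x} = 0<y-x⇒x<y (<-≤-trans 0<1 (≤.reflexive (solve 1 (λ x → 𝟙 := 𝟙 :+ x :- x) refl x)))

  1≤⇒0< : ∀ {x} → 1# ≤ x → 0# < x
  1≤⇒0< = <-≤-trans 0<1

  ⁻¹-nonNeg : ∀ {x} → 0# < x → 0# ≤ x ⁻¹
  ⁻¹-nonNeg {x} 0<x@(0≤x , 0≉x) with ≤.total 0# (x ⁻¹)
  ... | inj₁ 0≤x⁻¹ = 0≤x⁻¹
  ... | inj₂ x⁻¹≤0 = contradiction
    (begin
      1#         ≈⟨ *-inverseʳ x (<⇒≉ 0<x) ⟨
      x * x ⁻¹   ≤⟨ *-monoˡ-≤ 0≤x x⁻¹≤0 ⟩
      x * 0#     ≈⟨ zeroʳ x ⟩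
      0#         ∎)
    (<⇒≱ 0<1)

  *-⁻¹-cancel : ∀ {z} x → 0# < z → x * z * z ⁻¹ ≈ x
  *-⁻¹-cancel {z} x 0<z = begin-equality
    x * z * z ⁻¹    ≈⟨ *-assoc x z (z ⁻¹) ⟩
    x * (z * z ⁻¹)  ≈⟨ *-congˡ (*-inverseʳ z (<⇒≉ 0<z)) ⟩
    x * 1#          ≈⟨ *-identityʳ x ⟩
    x               ∎

  ⁻¹-*-cancel : ∀ {z} x → 0# < z → x * z ⁻¹ * z ≈ x
  ⁻¹-*-cancel {z} x 0<z = begin-equality
    x * z ⁻¹ * z   ≈⟨ solve 3 (λ x y z → x :* y :* z := x :* z :* y) refl x (z ⁻¹) z ⟩
    x * z * z ⁻¹   ≈⟨ *-⁻¹-cancel x 0<z ⟩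
    x              ∎

  *-cancelʳ-≤ : ∀ {z x y} → 0# < z → x * z ≤ y * z → x ≤ y
  *-cancelʳ-≤ {z} {x} {y} 0<z xz≤yz = begin
    x              ≈⟨ *-⁻¹-cancel x 0<z ⟨
    x * z * z ⁻¹   ≤⟨ *-monoʳ-≤ (⁻¹-nonNeg 0<z) xz≤yz ⟩
    y * z * z ⁻¹   ≈⟨ *-⁻¹-cancel y 0<z ⟩
    y              ∎

  *-cancelʳ-< : ∀ {z x y} → 0# ≤ z → x * z < y * z → x < y
  *-cancelʳ-< 0≤z xz<yz = ≰⇒> λ y≤x → <⇒≱ xz<yz (*-monoʳ-≤ 0≤z y≤x)

  *-pos : ∀ {x y} → 0# < x → 0# < y → 0# < x * y
  *-pos {x} {y} (0≤x , 0≉x) 0<y@(0≤y , _) = *-nonNeg 0≤x 0≤y , λ 0≈xy → 0≉x (begin-equality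
    0#            ≈⟨ zeroˡ (y ⁻¹) ⟨
    0# * y ⁻¹     ≈⟨ *-congʳ 0≈xy ⟩
    x * y * y ⁻¹  ≈⟨ *-⁻¹-cancel x 0<y ⟩
    x             ∎)

  ⁻¹-pos : ∀ {x} → 0# < x → 0# < x ⁻¹
  ⁻¹-pos {x} 0<x = ⁻¹-nonNeg 0<x , λ 0≈x⁻¹ → 0≉1 (begin-equality
    0#        ≈⟨ zeroʳ x ⟨
    x * 0#    ≈⟨ *-congˡ 0≈x⁻¹ ⟩
    x * x ⁻¹  ≈⟨ *-inverseʳ x (<⇒≉ 0<x) ⟩
    1#        ∎)

  ∣x∣<⇒x< : ∀ {x ε} → ∣ x ∣ < ε → x < ε
  ∣x∣<⇒x< {x} {ε} lt = begin-strict x ≤⟨ x≤x⊔y x (- x) ⟩ ∣ x ∣ <⟨ lt ⟩ ε ∎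

  ∣x∣<⇒-x< : ∀ {x ε} → ∣ x ∣ < ε → - x < ε
  ∣x∣<⇒-x< {x} {ε} lt = begin-strict - x ≤⟨ x≤y⊔x x (- x) ⟩ ∣ x ∣ <⟨ lt ⟩ ε ∎

  ∣x∣<-intro : ∀ {x ε} → x < ε → - x < ε → ∣ x ∣ < ε
  ∣x∣<-intro {x} {ε} x<ε -x<ε with ⊔-sel x (- x)
  ... | inj₁ eq = begin-strict ∣ x ∣ ≈⟨ eq ⟩ x <⟨ x<ε ⟩ ε ∎
  ... | inj₂ eq = begin-strict ∣ x ∣ ≈⟨ eq ⟩ - x <⟨ -x<ε ⟩ ε ∎

  -‿nonPos : ∀ {x} → 0# ≤ x → - x ≤ 0#
  -‿nonPos {x} 0≤x = ≤-gap 0≤x (sym (-‿inverseˡ x))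

  fromℕ-nonNeg : ∀ n → 0# ≤ fromℕ n
  fromℕ-nonNeg zero    = ≤.refl
  fromℕ-nonNeg (suc n) = proj₁ (0<fromℕ-suc n)

  fromℕ-mono-≤ : ∀ {m n} → m ℕ.≤ n → fromℕ m ≤ fromℕ n
  fromℕ-mono-≤ {n = n} z≤n = fromℕ-nonNeg n
  fromℕ-mono-≤ (s≤s m≤n)   = +-monoʳ-≤ 1# (fromℕ-mono-≤ m≤n)

  ^-nonNeg : ∀ {x} → 0# ≤ x → ∀ n → 0# ≤ x ^ n
  ^-nonNeg 0≤x zero    = 0≤1
  ^-nonNeg 0≤x (suc n) = *-nonNeg 0≤x (^-nonNeg 0≤x n)

  ^-monoˡ-≤ : ∀ {x y} n → 0# ≤ x → x ≤ y → x ^ n ≤ y ^ n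
  ^-monoˡ-≤ zero    0≤x x≤y = ≤.refl
  ^-monoˡ-≤ (suc n) 0≤x x≤y =
    *-mono-≤ 0≤x (^-nonNeg (≤.trans 0≤x x≤y) n) x≤y (^-monoˡ-≤ n 0≤x x≤y)

  1≤^ : ∀ {x} → 1# ≤ x → ∀ n → 1# ≤ x ^ n
  1≤^ 1≤x zero    = ≤.refl
  1≤^ {x} 1≤x (suc n) = begin
    1#       ≈⟨ *-identityˡ 1# ⟨
    1# * 1#  ≤⟨ *-mono-≤ 0≤1 (≤.trans 0≤1 (1≤^ 1≤x n)) 1≤x (1≤^ 1≤x n) ⟩
    x ^ suc n ∎

  ^-monoʳ-≤ : ∀ {x m n} → 1# ≤ x → m ℕ.≤ n → x ^ m ≤ x ^ n
  ^-monoʳ-≤ {n = n} 1≤x z≤n = 1≤^ 1≤x n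
  ^-monoʳ-≤ 1≤x (s≤s m≤n)   = *-monoˡ-≤ (≤.trans 0≤1 1≤x) (^-monoʳ-≤ 1≤x m≤n)

  -- Multiplying the estimate for `k` by `b` overshoots the one for `suc k` by (k + 1) a^k (b - a)²,
  -- which is nonnegative. This is the tangent line of a power function at `a`; taken at 1 it gives
  -- Bernoulli's inequality, and it also makes (1 + x/n)^n monotone in n.
  ^-tangent : ∀ {a b} k → 0# ≤ a → 0# ≤ b →
              a ^ k * (a + fromℕ (suc k) * (b - a)) ≤ b ^ suc k
  ^-tangent {a} {b} zero 0≤a 0≤b = ≤.reflexive
    (solve 2 (λ a b → 𝟙 :* (a :+ (𝟙 :+ con (+ 0)) :* (b :- a)) := b :* 𝟙) refl a b)
  ^-tangent {a} {b} (suc k) 0≤a 0≤b = begin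
    a * A * (a + (1# + c) * (b - a))
      ≤⟨ ≤-gap (*-nonNeg (*-nonNeg (^-nonNeg 0≤a k) (fromℕ-nonNeg (suc k))) (square-nonNeg (b - a)))
           (solve 4 (λ a b c A → b :* (A :* (a :+ c :* (b :- a))) :=
                                 a :* A :* (a :+ (𝟙 :+ c) :* (b :- a))
                                   :+ A :* c :* ((b :- a) :* (b :- a)))
              refl a b c A) ⟩
    b * (A * (a + c * (b - a)))
      ≤⟨ *-monoˡ-≤ 0≤b (^-tangent k 0≤a 0≤b) ⟩
    b * b ^ suc k
      ∎
    where
    A = a ^ k
    c = fromℕ (suc k)

  1^n≈1 : ∀ n → 1# ^ n ≈ 1#
  1^n≈1 zero    = refl
  1^n≈1 (suc n) = trans (*-identityˡ _) (1^n≈1 n)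

  bernoulli : ∀ {u} k → 0# ≤ u → 1# + fromℕ k * u ≤ (1# + u) ^ k
  bernoulli {u} zero    0≤u = ≤.reflexive (solve 1 (λ u → 𝟙 :+ con (+ 0) :* u := 𝟙) refl u)
  bernoulli {u} (suc k) 0≤u = begin
    1# + c * u                                  ≈⟨ solve 2 (λ c u → 𝟙 :+ c :* u :=
                                                     𝟙 :* (𝟙 :+ c :* (𝟙 :+ u :- 𝟙))) refl c u ⟩
    1# * (1# + c * (1# + u - 1#))               ≈⟨ *-congʳ (1^n≈1 k) ⟨
    1# ^ k * (1# + c * (1# + u - 1#))           ≤⟨ ^-tangent k 0≤1 (+-nonNeg 0≤1 0≤u) ⟩
    (1# + u) ^ suc k                            ∎
    where c = fromℕ (suc k)

  fromℕ-+ : ∀ m n → fromℕ (m ℕ.+ n) ≈ fromℕ m + fromℕ n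
  fromℕ-+ = ×-homo-+ 1#

  1+k≤2^k : ∀ k → 1# + fromℕ k ≤ (1# + 1#) ^ k
  1+k≤2^k k = ≤.trans (≤.reflexive (+-congˡ (sym (*-identityʳ (fromℕ k))))) (bernoulli k 0≤1)

  module Archimedean (lem : ExcludedMiddle 0ℓ) where

    archimedean : ∀ x → ∃ λ n → x ≤ fromℕ n
    archimedean x with lem {∃ λ n → x ≤ fromℕ n}
    ... | yes p = p
    ... | no ¬p = contradiction s≤s-1 (<⇒≱ (0<y-x⇒x<y
                    (<-≤-trans 0<1 (≤.reflexive (solve 1 (λ s → 𝟙 := s :- (s :- 𝟙)) refl s)))))
      where
      isNat : Carrier → Set
      isNat y = ∃ λ n → fromℕ n ≈ y
      sup : ∃ λ s → UpperBound isNat s × (∀ b → UpperBound isNat b → s ≤ b)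
      sup = supremum isNat (0# , 0 , refl)
        (x , λ { y (n , n≈y) → ≤.trans (≤.reflexive (sym n≈y)) (proj₁ (≰⇒> λ x≤n → ¬p (n , x≤n))) })
      s = proj₁ sup
      s≤s-1 : s ≤ s - 1#
      s≤s-1 = proj₂ (proj₂ sup) (s - 1#) λ { y (n , n≈y) → begin
        y                   ≈⟨ n≈y ⟨
        fromℕ n             ≈⟨ solve 1 (λ n → n := 𝟙 :+ n :- 𝟙) refl (fromℕ n) ⟩
        fromℕ (suc n) - 1#  ≤⟨ +-monoˡ-≤ (- 1#) (proj₁ (proj₂ sup) _ (suc n , refl)) ⟩
        s - 1#              ∎ }

    ≤-or-> : ∀ x y → x ≤ y ⊎ y < x
    ≤-or-> x y with lem {x ≤ y}
    ... | yes x≤y = inj₁ x≤y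
    ... | no  x≰y = inj₂ (≰⇒> x≰y)

-- Exponential function and logarithm, from the terms of the defining limit.

module Exponential (lem : ExcludedMiddle 0ℓ) (ℝ : CompleteOrderedField) where
  open CompleteOrderedField ℝ
  open Transcendental lem ℝ
  open OrderedField ℝ
  open Archimedean lem
  open IntegerSolver commutativeRing
  open Exp commutativeSemiring using (^-congˡ; ^-congʳ; ^-assocʳ)
  open ≤-Reasoning

  Monotone : (ℕ → Carrier) → Set
  Monotone s = ∀ n → s n ≤ s (suc n)

  Eventually : (ℕ → Set) → Set
  Eventually P = ∃ λ n₀ → ∀ n → n₀ ℕ.≤ n → P n

  monotone-≤ : ∀ {s} → Monotone s → ∀ {m n} → m ℕ.≤ n → s m ≤ s n
  monotone-≤ {s} mono m≤n = go (ℕ.≤⇒≤′ m≤n)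
    where
    go : ∀ {m n} → m ℕ.≤′ n → s m ≤ s n
    go (ℕ.≤′-reflexive ≡.refl) = ≤.refl
    go (ℕ.≤′-step m≤′n)        = ≤.trans (go m≤′n) (mono _)

  monotone-convergent : ∀ {s b} → Monotone s → (∀ n → s n ≤ b) → ∃ λ l → s ⟶ l
  monotone-convergent {s} {b} mono s≤b = l , converges
    where
    range : Carrier → Set
    range x = ∃ λ n → s n ≈ x
    sup : ∃ λ l → UpperBound range l × (∀ b → UpperBound range b → l ≤ b)
    sup = supremum range (s 0 , 0 , refl)
            (b , λ { x (n , sn≈x) → ≤.trans (≤.reflexive (sym sn≈x)) (s≤b n) })
    l = proj₁ sup
    s≤l : ∀ n → s n ≤ l
    s≤l n = proj₁ (proj₂ sup) (s n) (n , refl)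
    converges : s ⟶ l
    converges ε 0<ε with lem {∃ λ n → l - ε < s n}
    ... | yes (n₀ , lt) = n₀ , λ n n₀≤n → ∣x∣<-intro
      (begin-strict
        s n - l  ≤⟨ x≤y+z⇒x-z≤y (≤.trans (s≤l n) (≤.reflexive (sym (+-identityˡ l)))) ⟩
        0#       <⟨ 0<ε ⟩
        ε        ∎)
      (0<y-x⇒x<y (begin-strict
        0#                   <⟨ x<y⇒0<y-x (<-≤-trans lt (monotone-≤ mono n₀≤n)) ⟩
        s n - (l - ε)        ≈⟨ solve 3 (λ x l e → x :- (l :- e) := e :- (:- (x :- l))) refl (s n) l ε ⟩
        ε - (- (s n - l))    ∎))
    ... | no ¬lt = contradiction l≤l-ε (<⇒≱ (0<y-x⇒x<y (<-≤-trans 0<ε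
                     (≤.reflexive (solve 2 (λ l e → e := l :- (l :- e)) refl l ε)))))
      where
      l≤l-ε : l ≤ l - ε
      l≤l-ε = proj₂ (proj₂ sup) (l - ε) λ { x (n , sn≈x) → ≤.trans (≤.reflexive (sym sn≈x)) (le n) }
        where
        le : ∀ n → s n ≤ l - ε
        le n with ≤-or-> (s n) (l - ε)
        ... | inj₁ p = p
        ... | inj₂ p = contradiction (n , p) ¬lt

  ⟶-≤ : ∀ {s l b} → s ⟶ l → Eventually (λ n → s n ≤ b) → l ≤ b
  ⟶-≤ {s} {l} {b} s⟶l (n₀ , s≤b) with ≤-or-> l b
  ... | inj₁ l≤b = l≤b
  ... | inj₂ b<l with s⟶l (l - b) (x<y⇒0<y-x b<l)
  ... | n₁ , close = contradiction (s≤b n (ℕ.m≤m⊔n n₀ n₁)) (<⇒≱ (0<y-x⇒x<y (begin-strict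
      0#                           <⟨ x<y⇒0<y-x (∣x∣<⇒-x< (close n (ℕ.m≤n⊔m n₀ n₁))) ⟩
      l - b - (- (s n - l))        ≈⟨ solve 3 (λ l b x → l :- b :- (:- (x :- l)) := x :- b) refl l b (s n) ⟩
      s n - b                      ∎)))
    where n = n₀ ℕ.⊔ n₁

  ⟶-≥ : ∀ {s l} → s ⟶ l → Monotone s → ∀ n → s n ≤ l
  ⟶-≥ {s} {l} s⟶l mono n with ≤-or-> (s n) l
  ... | inj₁ sn≤l = sn≤l
  ... | inj₂ l<sn with s⟶l (s n - l) (x<y⇒0<y-x l<sn)
  ... | n₁ , close = contradiction (monotone-≤ mono (ℕ.m≤m⊔n n n₁)) (<⇒≱ (0<y-x⇒x<y (begin-strict
      0#                       <⟨ x<y⇒0<y-x (∣x∣<⇒x< (close m (ℕ.m≤n⊔m n n₁))) ⟩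
      s n - l - (s m - l)      ≈⟨ solve 3 (λ x y l → x :- l :- (y :- l) := x :- y) refl (s n) (s m) l ⟩
      s n - s m                ∎)))
    where m = n ℕ.⊔ n₁

  -- The premise on `b` covers the default value of `lim`, so the bound holds whether or not `s`
  -- converges.
  lim-≤ : ∀ {s b} → 0# ≤ b → Eventually (λ n → s n ≤ b) → lim s ≤ b
  lim-≤ {s} 0≤b s≤b with lem {∃ λ l → s ⟶ l}
  ... | yes (l , s⟶l) = ⟶-≤ s⟶l s≤b
  ... | no  _         = 0≤b

  -- Here the default value could break the bound; monotonicity and the upper bound `b` exclude it
  -- by forcing convergence.
  ≤-lim : ∀ {s b} → Monotone s → (∀ n → s n ≤ b) → ∀ n → s n ≤ lim s
  ≤-lim {s} mono s≤b with lem {∃ λ l → s ⟶ l}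
  ... | yes (l , s⟶l) = ⟶-≥ s⟶l mono
  ... | no  ¬conv     = contradiction (monotone-convergent mono s≤b) ¬conv

  -- Passing from k to k + 1 leaves the surplus (a + v)^k ((a - 1) v + (k + 1) v²), nonnegative
  -- because `a` is at least 1. With v = h / n and exponent n the factor becomes 1 - h, free of n,
  -- so the estimate survives the limit.
  ^-shift : ∀ {a v} k → 1# ≤ a → 0# ≤ v → (a + v) ^ k * (1# - fromℕ k * v) ≤ a ^ k
  ^-shift {a} {v} zero 1≤a 0≤v = ≤.reflexive
    (solve 1 (λ v → 𝟙 :* (𝟙 :- con (+ 0) :* v) := 𝟙) refl v)
  ^-shift {a} {v} (suc k) 1≤a 0≤v = begin
    (a + v) * B * (1# - (1# + c) * v)
      ≤⟨ ≤-gap (*-nonNeg (^-nonNeg (+-nonNeg 0≤a 0≤v) k)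
                  (+-nonNeg (*-nonNeg (x≤y⇒0≤y-x 1≤a) 0≤v)
                            (*-nonNeg (fromℕ-nonNeg (suc k)) (*-nonNeg 0≤v 0≤v))))
           (solve 4 (λ a v B c → a :* (B :* (𝟙 :- c :* v)) :=
               (a :+ v) :* B :* (𝟙 :- (𝟙 :+ c) :* v)
                 :+ B :* ((a :- 𝟙) :* v :+ (𝟙 :+ c) :* (v :* v)))
              refl a v B c) ⟩
    a * (B * (1# - c * v))
      ≤⟨ *-monoˡ-≤ 0≤a (^-shift k 1≤a 0≤v) ⟩
    a * a ^ k
      ∎
    where
    0≤a = ≤.trans 0≤1 1≤a
    B = (a + v) ^ k
    c = fromℕ k

  recip : ℕ → Carrier
  recip n = fromℕ (suc n) ⁻¹

  recip-nonNeg : ∀ n → 0# ≤ recip n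
  recip-nonNeg n = ⁻¹-nonNeg (0<fromℕ-suc n)

  *-recip : ∀ n → fromℕ (suc n) * recip n ≈ 1#
  *-recip n = *-inverseʳ _ (<⇒≉ (0<fromℕ-suc n))

  fromℕ-*-recip : ∀ n x → fromℕ (suc n) * (x * recip n) ≈ x
  fromℕ-*-recip n x = begin-equality
    fromℕ (suc n) * (x * recip n)   ≈⟨ solve 3 (λ c x q → c :* (x :* q) := c :* q :* x) refl
                                         (fromℕ (suc n)) x (recip n) ⟩
    fromℕ (suc n) * recip n * x     ≈⟨ *-congʳ (*-recip n) ⟩
    1# * x                          ≈⟨ *-identityˡ x ⟩
    x                               ∎

  -- `exp x` unfolds to the limit of `E x`.
  E : Carrier → ℕ → Carrier
  E x n = (1# + x * recip n) ^ suc n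

  0≤x*recip : ∀ {x} n → 0# ≤ x → 0# ≤ x * recip n
  0≤x*recip n 0≤x = *-nonNeg 0≤x (recip-nonNeg n)

  0≤1+x*recip : ∀ {x} n → 0# ≤ x → 0# ≤ 1# + x * recip n
  0≤1+x*recip n 0≤x = +-nonNeg 0≤1 (0≤x*recip n 0≤x)

  E-nonNeg : ∀ {x} n → 0# ≤ x → 0# ≤ E x n
  E-nonNeg n 0≤x = ^-nonNeg (0≤1+x*recip n 0≤x) (suc n)

  -- The tangent to the power n + 2 at 1 + x/(n + 1), evaluated at 1 + x/(n + 2), has linear factor
  -- exactly 1; what is left of `^-tangent` is the claim.
  E-monotone : ∀ {x} → 0# ≤ x → Monotone (E x)
  E-monotone {x} 0≤x n = begin
    a ^ suc n                                         ≈⟨ *-identityʳ _ ⟨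
    a ^ suc n * 1#                                    ≈⟨ *-congˡ tangent≈1 ⟨
    a ^ suc n * (a + (1# + c) * (b - a))              ≤⟨ ^-tangent (suc n) (0≤1+x*recip n 0≤x)
                                                           (0≤1+x*recip (suc n) 0≤x) ⟩
    b ^ suc (suc n)                                   ∎
    where
    c = fromℕ (suc n)
    p = recip n
    q = recip (suc n)
    a = 1# + x * p
    b = 1# + x * q
    tangent≈1 : a + (1# + c) * (b - a) ≈ 1#
    tangent≈1 = begin-equality
      a + (1# + c) * (b - a)                   ≈⟨ solve 4 (λ x c p q →
          𝟙 :+ x :* p :+ (𝟙 :+ c) :* (𝟙 :+ x :* q :- (𝟙 :+ x :* p)) :=
          𝟙 :+ x :* ((𝟙 :+ c) :* q :- c :* p)) refl x c p q ⟩
      1# + x * ((1# + c) * q - c * p)          ≈⟨ +-congˡ (*-congˡ (+-cong (*-recip (suc n)) (-‿cong (*-recip n)))) ⟩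
      1# + x * (1# - 1#)                       ≈⟨ solve 1 (λ x → 𝟙 :+ x :* (𝟙 :- 𝟙) := 𝟙) refl x ⟩
      1#                                       ∎

  E-≤ : ∀ {x y} n → 0# ≤ 1# + x * recip n → x ≤ y → E x n ≤ E y n
  E-≤ n 0≤ x≤y = ^-monoˡ-≤ (suc n) 0≤ (+-monoʳ-≤ 1# (*-monoʳ-≤ (recip-nonNeg n) x≤y))

  1+x≤E : ∀ {x} n → 0# ≤ x → 1# + x ≤ E x n
  1+x≤E {x} n 0≤x = begin
    1# + x                                ≈⟨ +-congˡ (fromℕ-*-recip n x) ⟨
    1# + fromℕ (suc n) * (x * recip n)    ≤⟨ bernoulli (suc n) (0≤x*recip n 0≤x) ⟩
    E x n                                 ∎

  -- Bernoulli's inequality, applied to the base, turns the factor k into an exponent. At the level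
  -- of terms this stands in for one direction of exp (k u) = (exp u)^k.
  E-multiple : ∀ {u} k n → 0# ≤ u → E (fromℕ k * u) n ≤ E u n ^ k
  E-multiple {u} k n 0≤u = begin
    (1# + fromℕ k * u * q) ^ suc n      ≈⟨ ^-congˡ (suc n) (+-congˡ (*-assoc _ u q)) ⟩
    (1# + fromℕ k * (u * q)) ^ suc n    ≤⟨ ^-monoˡ-≤ (suc n) (+-nonNeg 0≤1 (*-nonNeg (fromℕ-nonNeg k)
                                             (0≤x*recip n 0≤u))) (bernoulli k (0≤x*recip n 0≤u)) ⟩
    ((1# + u * q) ^ k) ^ suc n          ≈⟨ ^-assocʳ _ k (suc n) ⟩
    (1# + u * q) ^ (k ℕ.* suc n)        ≈⟨ ^-congʳ _ (ℕ.*-comm k (suc n)) ⟩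
    (1# + u * q) ^ (suc n ℕ.* k)        ≈⟨ ^-assocʳ _ (suc n) k ⟨
    E u n ^ k                           ∎
    where q = recip n

  E-shift : ∀ {s h} n → 0# ≤ s → 0# ≤ h → E (s + h) n * (1# - h) ≤ E s n
  E-shift {s} {h} n 0≤s 0≤h = begin
    E (s + h) n * (1# - h)
      ≈⟨ *-cong (^-congˡ (suc n) (solve 3 (λ s h q → 𝟙 :+ (s :+ h) :* q := 𝟙 :+ s :* q :+ h :* q) refl s h q))
                (+-congˡ (-‿cong (sym (fromℕ-*-recip n h)))) ⟩
    (1# + s * q + h * q) ^ suc n * (1# - fromℕ (suc n) * (h * q))
      ≤⟨ ^-shift (suc n) (≤-gap (0≤x*recip n 0≤s) refl) (0≤x*recip n 0≤h) ⟩
    E s n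
      ∎
    where q = recip n

  E0≤1 : ∀ n → E 0# n ≤ 1#
  E0≤1 n = ≤.reflexive (trans (^-congˡ (suc n) (solve 1 (λ q → 𝟙 :+ con (+ 0) :* q := 𝟙) refl (recip n)))
                              (1^n≈1 (suc n)))

  -- Shifting from 0 by `u` gives E u n (1 - u) ≤ 1, and 1 - u is at least 1/2.
  E≤2 : ∀ {u} n → 0# ≤ u → u + u ≤ 1# → E u n ≤ 1# + 1#
  E≤2 {u} n 0≤u 2u≤1 = begin
    w                                  ≤⟨ ≤-gap (*-nonNeg (E-nonNeg n 0≤u) (x≤y⇒0≤y-x 2u≤1))
                                            (solve 2 (λ w u → (𝟙 :+ 𝟙) :* (w :* (𝟙 :- u)) :=
                                               w :+ w :* (𝟙 :- (u :+ u))) refl w u) ⟩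
    (1# + 1#) * (w * (1# - u))         ≤⟨ *-monoˡ-≤ (+-nonNeg 0≤1 0≤1) w[1-u]≤1 ⟩
    (1# + 1#) * 1#                     ≈⟨ *-identityʳ _ ⟩
    1# + 1#                            ∎
    where
    w = E u n
    w[1-u]≤1 : w * (1# - u) ≤ 1#
    w[1-u]≤1 = begin
      w * (1# - u)            ≈⟨ *-congʳ (^-congˡ (suc n) (+-congˡ (*-congʳ (+-identityˡ u)))) ⟨
      E (0# + u) n * (1# - u) ≤⟨ E-shift n ≤.refl 0≤u ⟩
      E 0# n                  ≤⟨ E0≤1 n ⟩
      1#                      ∎

  -- Cutting `x` into m + 1 equal pieces of size at most 1/2 reduces the bound to `E≤2`; m is a
  -- natural number above 2x.
  E-bounded : ∀ {x} → 0# ≤ x → ∃ λ b → ∀ n → E x n ≤ b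
  E-bounded {x} 0≤x = (1# + 1#) ^ suc m , λ n → begin
    E x n                    ≈⟨ ^-congˡ (suc n) (+-congˡ (*-congʳ (fromℕ-*-recip m x))) ⟨
    E (fromℕ (suc m) * u) n  ≤⟨ E-multiple (suc m) n 0≤u ⟩
    E u n ^ suc m            ≤⟨ ^-monoˡ-≤ (suc m) (E-nonNeg n 0≤u) (E≤2 n 0≤u 2u≤1) ⟩
    (1# + 1#) ^ suc m        ∎
    where
    m = proj₁ (archimedean (x + x))
    u = x * recip m
    0≤u : 0# ≤ u
    0≤u = 0≤x*recip m 0≤x
    2u≤1 : u + u ≤ 1#
    2u≤1 = begin
      u + u                     ≈⟨ distribʳ (recip m) x x ⟨
      (x + x) * recip m         ≤⟨ *-monoʳ-≤ (recip-nonNeg m)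
                                     (≤.trans (proj₂ (archimedean (x + x))) (x≤1+x (fromℕ m))) ⟩
      fromℕ (suc m) * recip m   ≈⟨ *-recip m ⟩
      1#                        ∎

  E≤exp : ∀ {x} n → 0# ≤ x → E x n ≤ exp x
  E≤exp n 0≤x = ≤-lim (E-monotone 0≤x) (proj₂ (E-bounded 0≤x)) n

  exp-≤ : ∀ {x b} → 0# ≤ b → (∀ n → E x n ≤ b) → exp x ≤ b
  exp-≤ 0≤b E≤b = lim-≤ 0≤b (0 , λ n _ → E≤b n)

  1+x≤exp : ∀ {x} → 0# ≤ x → 1# + x ≤ exp x
  1+x≤exp 0≤x = ≤.trans (1+x≤E 0 0≤x) (E≤exp 0 0≤x)

  0<exp : ∀ {x} → 0# ≤ x → 0# < exp x
  0<exp 0≤x = 1≤⇒0< (≤.trans (≤-gap 0≤x refl) (1+x≤exp 0≤x))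

  exp-mono-≤ : ∀ {x y} → 0# ≤ x → x ≤ y → exp x ≤ exp y
  exp-mono-≤ 0≤x x≤y = exp-≤ (proj₁ (0<exp (≤.trans 0≤x x≤y))) λ n →
    ≤.trans (E-≤ n (0≤1+x*recip n 0≤x) x≤y) (E≤exp n (≤.trans 0≤x x≤y))

  -- This is all the continuity of exp that surjectivity needs.
  exp-shift : ∀ {s h} → 0# ≤ s → 0# ≤ h → exp (s + h) * (1# - h) ≤ exp s
  exp-shift {s} {h} 0≤s 0≤h with ≤-or-> (1# - h) 0#
  ... | inj₁ 1-h≤0 = begin
    exp (s + h) * (1# - h)   ≤⟨ *-monoˡ-≤ (proj₁ (0<exp (+-nonNeg 0≤s 0≤h))) 1-h≤0 ⟩
    exp (s + h) * 0#         ≈⟨ zeroʳ _ ⟩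
    0#                       ≤⟨ proj₁ (0<exp 0≤s) ⟩
    exp s                    ∎
  -- The limit itself is bounded termwise, so the factor is first moved to the other side, which
  -- needs it positive.
  ... | inj₂ 0<1-h = begin
    exp (s + h) * (1# - h)                 ≤⟨ *-monoʳ-≤ (proj₁ 0<1-h) (exp-≤
                                                (*-nonNeg (proj₁ (0<exp 0≤s)) (⁻¹-nonNeg 0<1-h)) bound) ⟩
    exp s * (1# - h) ⁻¹ * (1# - h)         ≈⟨ ⁻¹-*-cancel (exp s) 0<1-h ⟩
    exp s                                  ∎
    where
    bound : ∀ n → E (s + h) n ≤ exp s * (1# - h) ⁻¹
    bound n = *-cancelʳ-≤ 0<1-h (begin
      E (s + h) n * (1# - h)          ≤⟨ E-shift n 0≤s 0≤h ⟩
      E s n                           ≤⟨ E≤exp n 0≤s ⟩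
      exp s                           ≈⟨ ⁻¹-*-cancel (exp s) 0<1-h ⟨
      exp s * (1# - h) ⁻¹ * (1# - h)  ∎)

  2≤e : 1# + 1# ≤ e
  2≤e = 1+x≤exp 0≤1

  1≤e : 1# ≤ e
  1≤e = ≤.trans (x≤1+x 1#) 2≤e

  0≤e : 0# ≤ e
  0≤e = ≤.trans 0≤1 1≤e

  -- For x < 0 the factors 1 + x / n are nonnegative from some n on, and only
  -- those matter for the limit.
  exp-≤-e^ : ∀ {x} k → x ≤ fromℕ k → exp x ≤ e ^ k
  exp-≤-e^ {x} k x≤k = lim-≤ (^-nonNeg 0≤e k) (n₀ , λ n n₀≤n → begin
    E x n                 ≤⟨ E-≤ n (0≤1+xq n n₀≤n) x≤k ⟩
    E (fromℕ k) n         ≈⟨ ^-congˡ (suc n) (+-congˡ (*-congʳ (*-identityʳ (fromℕ k)))) ⟨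
    E (fromℕ k * 1#) n    ≤⟨ E-multiple k n 0≤1 ⟩
    E 1# n ^ k            ≤⟨ ^-monoˡ-≤ k (E-nonNeg n 0≤1) (E≤exp n 0≤1) ⟩
    e ^ k                 ∎)
    where
    n₀ = proj₁ (archimedean (- x))
    0≤1+xq : ∀ n → n₀ ℕ.≤ n → 0# ≤ 1# + x * recip n
    0≤1+xq n n₀≤n = begin
      0#                             ≤⟨ *-nonNeg (x≤y⇒0≤y-x -x≤1+n) (recip-nonNeg n) ⟩
      (c - (- x)) * q                ≈⟨ solve 3 (λ c x q → (c :- (:- x)) :* q := c :* q :+ x :* q) refl c x q ⟩
      c * q + x * q                  ≈⟨ +-congʳ (*-recip n) ⟩
      1# + x * q                     ∎
      where
      c = fromℕ (suc n)
      q = recip n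
      -x≤1+n : - x ≤ c
      -x≤1+n = ≤.trans (proj₂ (archimedean (- x))) (fromℕ-mono-≤ (ℕ.m≤n⇒m≤1+n n₀≤n))

  x+[s-x]≈s : ∀ x s → x + (s - x) ≈ s
  x+[s-x]≈s = solve 2 (λ x s → x :+ (s :- x) := s) refl

  ≤-shift : ∀ {s x z} → 1# - (s - x) ≤ z → x ≤ s - (1# - z)
  ≤-shift {s} {x} {z} le = ≤-gap (x≤y⇒0≤y-x le)
    (solve 3 (λ s x z → s :- (𝟙 :- z) := x :+ (z :- (𝟙 :- (s :- x)))) refl s x z)

  s≤s-[1-z]⇒1≤z : ∀ {s z} → s ≤ s - (1# - z) → 1# ≤ z
  s≤s-[1-z]⇒1≤z {s} {z} le = ≤-gap (x≤y⇒0≤y-x le)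
    (solve 2 (λ s z → z := 𝟙 :+ (s :- (𝟙 :- z) :- s)) refl s z)

  s+[1-z]≤s⇒1≤z : ∀ {s z} → s + (1# - z) ≤ s → 1# ≤ z
  s+[1-z]≤s⇒1≤z {s} {z} le = ≤-gap (x≤y⇒0≤y-x le)
    (solve 2 (λ s z → z := 𝟙 :+ (s :- (s :+ (𝟙 :- z)))) refl s z)

  w*[zy]≈w*[1-[1-z]]*y : ∀ w z y → w * (z * y) ≈ w * (1# - (1# - z)) * y
  w*[zy]≈w*[1-[1-z]]*y = solve 3 (λ w z y → w :* (z :* y) := w :* (𝟙 :- (𝟙 :- z)) :* y) refl

  module _ {y} (1≤y : 1# ≤ y) where
    Below : Carrier → Set
    Below x = 0# ≤ x × exp x ≤ y

    0∈Below : Below 0#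
    0∈Below = ≤.refl , ≤.trans (exp-≤-e^ 0 ≤.refl) 1≤y

    Below-bounded : UpperBound Below y
    Below-bounded x (0≤x , exp[x]≤y) = ≤.trans (x≤1+x x) (≤.trans (1+x≤exp 0≤x) exp[x]≤y)

    module _ {s} (Below≤s : UpperBound Below s) where
      0≤s : 0# ≤ s
      0≤s = Below≤s 0# 0∈Below

      -- The step 1 - y / exp s is chosen so that `exp-shift` from any x in `Below` to s gives exp s
      -- (1 - (s - x)) ≤ exp x ≤ y, hence x ≤ s - (1 - y / exp s). Leastness of s then forces the
      -- step to be at most 0.
      exp[sup]≤y : (∀ b → UpperBound Below b → s ≤ b) → exp s ≤ y
      exp[sup]≤y least = begin
        exp s                  ≈⟨ *-identityˡ (exp s) ⟨
        1# * exp s             ≤⟨ *-monoʳ-≤ (proj₁ 0<g) (s≤s-[1-z]⇒1≤z (least _ Below≤s-h)) ⟩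
        y * exp s ⁻¹ * exp s   ≈⟨ ⁻¹-*-cancel y 0<g ⟩
        y                      ∎
        where
        0<g : 0# < exp s
        0<g = 0<exp 0≤s
        Below≤s-h : UpperBound Below (s - (1# - y * exp s ⁻¹))
        Below≤s-h x x∈@(0≤x , exp[x]≤y) = ≤-shift (*-cancelʳ-≤ 0<g (begin
          (1# - (s - x)) * exp s               ≈⟨ *-comm _ (exp s) ⟩
          exp s * (1# - (s - x))               ≈⟨ *-congʳ g≈ ⟩
          exp (x + (s - x)) * (1# - (s - x))   ≤⟨ exp-shift 0≤x 0≤s-x ⟩
          exp x                                ≤⟨ exp[x]≤y ⟩
          y                                    ≈⟨ ⁻¹-*-cancel y 0<g ⟨
          y * exp s ⁻¹ * exp s                 ∎))
          where
          0≤s-x : 0# ≤ s - x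
          0≤s-x = x≤y⇒0≤y-x (Below≤s x x∈)
          -- `exp` is defined by a case distinction on the existence of a limit, so that it respects
          -- `≈` is not automatic; monotonicity in both directions supplies it.
          g≈ : exp s ≈ exp (x + (s - x))
          g≈ = ≤.antisym (exp-mono-≤ 0≤s (≤.reflexive (sym (x+[s-x]≈s x s))))
                         (exp-mono-≤ (+-nonNeg 0≤x 0≤s-x) (≤.reflexive (x+[s-x]≈s x s)))

      -- If exp s < y, the step h = 1 - exp s / y turns `exp-shift` into exp (s + h) ≤ y. Then s + h
      -- lies in `Below`, and s being an upper bound gives h ≤ 0, that is, y ≤ exp s.
      y≤exp[sup] : y ≤ exp s
      y≤exp[sup] with ≤-or-> y (exp s)
      ... | inj₁ y≤g = y≤g
      ... | inj₂ g<y = begin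
        y                   ≈⟨ *-identityˡ y ⟨
        1# * y              ≤⟨ *-monoʳ-≤ (proj₁ 0<y) (s+[1-z]≤s⇒1≤z (Below≤s _ (+-nonNeg 0≤s 0≤h , exp[s+h]≤y))) ⟩
        exp s * y ⁻¹ * y    ≈⟨ ⁻¹-*-cancel (exp s) 0<y ⟩
        exp s               ∎
        where
        0<y : 0# < y
        0<y = 1≤⇒0< 1≤y
        h : Carrier
        h = 1# - exp s * y ⁻¹
        0≤h : 0# ≤ h
        0≤h = x≤y⇒0≤y-x (*-cancelʳ-≤ 0<y (begin
          exp s * y ⁻¹ * y   ≈⟨ ⁻¹-*-cancel (exp s) 0<y ⟩
          exp s              ≤⟨ proj₁ g<y ⟩
          y                  ≈⟨ *-identityˡ y ⟨
          1# * y             ∎))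
        exp[s+h]≤y : exp (s + h) ≤ y
        exp[s+h]≤y = *-cancelʳ-≤ (0<exp 0≤s) (begin
          exp (s + h) * exp s                 ≈⟨ *-congˡ (⁻¹-*-cancel (exp s) 0<y) ⟨
          exp (s + h) * (exp s * y ⁻¹ * y)    ≈⟨ w*[zy]≈w*[1-[1-z]]*y _ _ y ⟩
          exp (s + h) * (1# - h) * y          ≤⟨ *-monoʳ-≤ (proj₁ 0<y) (exp-shift 0≤s 0≤h) ⟩
          exp s * y                           ≈⟨ *-comm (exp s) y ⟩
          y * exp s                           ∎)

  exp-surjective : ∀ {y} → 1# ≤ y → ∃ λ x → exp x ≈ y
  exp-surjective {y} 1≤y = attained
    (supremum (Below 1≤y) (0# , 0∈Below 1≤y) (y , Below-bounded 1≤y))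
    where
    attained : (∃ λ s → UpperBound (Below 1≤y) s × (∀ b → UpperBound (Below 1≤y) b → s ≤ b)) →
               ∃ λ x → exp x ≈ y
    attained (s , Below≤s , least) = s , ≤.antisym (exp[sup]≤y 1≤y Below≤s least) (y≤exp[sup] 1≤y Below≤s)

  exp[ln] : ∀ {y} → 1# ≤ y → exp (ln y) ≈ y
  exp[ln] {y} 1≤y with lem {∃ λ x → exp x ≈ y}
  ... | yes (_ , exp[x]≈y) = exp[x]≈y
  ... | no  ¬∃             = contradiction (exp-surjective 1≤y) ¬∃

  -- `ln y` is only known to be some preimage of `y`, of unknown sign, so monotonicity of `exp` on
  -- nonnegative arguments would not do; `exp-≤-e^` accepts every sign.
  k≤ln : ∀ {y} k → e ^ k < y → fromℕ k ≤ ln y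
  k≤ln {y} k e^k<y with ≤-or-> (fromℕ k) (ln y)
  ... | inj₁ k≤ln[y] = k≤ln[y]
  ... | inj₂ ln[y]<k = contradiction
    (≤.trans (≤.reflexive (sym (exp[ln] (≤.trans (1≤^ 1≤e k) (proj₁ e^k<y))))) (exp-≤-e^ k (proj₁ ln[y]<k)))
    (<⇒≱ e^k<y)

  1+k≤e^k : ∀ k → 1# + fromℕ k ≤ e ^ k
  1+k≤e^k k = ≤.trans (1+k≤2^k k) (^-monoˡ-≤ k (+-nonNeg 0≤1 0≤1) 2≤e)

  e^-bracket : ∀ {y} → 1# < y → ∃ λ k → e ^ k < y × y ≤ e ^ suc k
  e^-bracket {y} 1<y = descend n (≤.trans (proj₂ (archimedean y)) (≤.trans (x≤1+x _) (1+k≤e^k n)))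
    where
    n = proj₁ (archimedean y)
    descend : ∀ n → y ≤ e ^ n → ∃ λ k → e ^ k < y × y ≤ e ^ suc k
    descend zero    y≤1    = contradiction y≤1 (<⇒≱ 1<y)
    descend (suc n) y≤e^1+n with ≤-or-> y (e ^ n)
    ... | inj₁ y≤e^n = descend n y≤e^n
    ... | inj₂ e^n<y = n , e^n<y , y≤e^1+n

-- Mean value inequality for a derivative bounded below.

module MeanValue (lem : ExcludedMiddle 0ℓ) (ℝ : CompleteOrderedField) where
  open CompleteOrderedField ℝ
  open OrderedField ℝ
  open Archimedean lem
  open IntegerSolver commutativeRing
  open ≤-Reasoning
  open Func

  0<⇒∃half : ∀ {δ} → 0# < δ → ∃ λ η → 0# < η × η < δ
  0<⇒∃half {δ} 0<δ = η , 0<η , 0<y-x⇒x<y (<-≤-trans 0<η (≤.reflexive η≈δ-η))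
    where
    2# = 1# + 1#
    0<2 : 0# < 2#
    0<2 = 1≤⇒0< (x≤1+x 1#)
    η = δ * 2# ⁻¹
    0<η : 0# < η
    0<η = *-pos 0<δ (⁻¹-pos 0<2)
    η≈δ-η : η ≈ δ - η
    η≈δ-η = begin-equality
      η             ≈⟨ solve 1 (λ η → η := η :* (𝟙 :+ 𝟙) :- η) refl η ⟩
      η * 2# - η    ≈⟨ +-congʳ (⁻¹-*-cancel δ 0<2) ⟩
      δ - η         ∎

  ≤-from-below : ∀ {c d} → (∀ m → m < c → m ≤ d) → c ≤ d
  ≤-from-below {c} {d} below with ≤-or-> c d
  ... | inj₁ c≤d = c≤d
  ... | inj₂ d<c with η , 0<η , η<c-d ← 0<⇒∃half (x<y⇒0<y-x d<c) = contradiction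
    (below (c - η) (0<y-x⇒x<y (<-≤-trans 0<η (≤.reflexive
      (solve 2 (λ c e → e := c :- (c :- e)) refl c η)))))
    (<⇒≱ (0<y-x⇒x<y (<-≤-trans (x<y⇒0<y-x η<c-d) (≤.reflexive
      (solve 3 (λ c d e → c :- d :- e := c :- e :- d) refl c d η)))))

  module _ (f f′ : Func ℝ⁺ setoid) (f-derivative : IsDerivative f f′) where

    -- Multiplied out, the secant bound also covers points equal to `a`, about which the difference
    -- quotient says nothing. The two orders of `x` and `a` are kept apart so that the length of the
    -- interval is nonnegative in each.
    SlopeNear : Carrier → Pos → Carrier → Set
    SlopeNear m a δ = ∀ x → ∣ value x - value a ∣ < δ →
      (value a ≤ value x → m * (value x - value a) ≤ to f x - to f a) ×
      (value x ≤ value a → m * (value a - value x) ≤ to f a - to f x)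

    slope-near : ∀ a {m} → m < to f′ a → ∃ λ δ → 0# < δ × SlopeNear m a δ
    -- The gap between `to f′ a` and `m` is the tolerance, so every nearby difference quotient is at
    -- least `m`.
    slope-near a {m} m<f′a with δ , 0<δ , close ← f-derivative a (to f′ a - m) (x<y⇒0<y-x m<f′a) =
      δ , 0<δ , slope
      where
      slope : SlopeNear m a δ
      slope x near with lem {value x ≈ value a}
      ... | yes x≈a = (λ _ → ≤.reflexive (flat x≈a (cong f x≈a))) ,
                      (λ _ → ≤.reflexive (flat (sym x≈a) (cong f (sym x≈a))))
        where
        flat : ∀ {u v p q} → u ≈ v → p ≈ q → m * (u - v) ≈ p - q
        flat {u} {v} {p} {q} u≈v p≈q = begin-equality
          m * (u - v)   ≈⟨ *-congˡ (+-congʳ u≈v) ⟩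
          m * (v - v)   ≈⟨ solve 3 (λ m v q → m :* (v :- v) := q :- q) refl m v q ⟩
          q - q         ≈⟨ +-congʳ p≈q ⟨
          p - q         ∎
      ... | no x≉a = right , left
        where
        d = value x - value a
        D = (to f x - to f a) * d ⁻¹
        d≉0 : ¬ d ≈ 0#
        d≉0 d≈0 = x≉a (begin-equality
          value x                ≈⟨ solve 2 (λ x a → x := x :- a :+ a) refl (value x) (value a) ⟩
          d + value a            ≈⟨ +-congʳ d≈0 ⟩
          0# + value a           ≈⟨ +-identityˡ _ ⟩
          value a                ∎)
        Dd≈ : D * d ≈ to f x - to f a
        Dd≈ = begin-equality
          (to f x - to f a) * d ⁻¹ * d     ≈⟨ solve 3 (λ y i d → y :* i :* d := y :* (d :* i)) refl
                                               (to f x - to f a) (d ⁻¹) d ⟩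
          (to f x - to f a) * (d * d ⁻¹)   ≈⟨ *-congˡ (*-inverseʳ d d≉0) ⟩
          (to f x - to f a) * 1#           ≈⟨ *-identityʳ _ ⟩
          to f x - to f a                  ∎
        m≤D : m ≤ D
        m≤D = proj₁ (0<y-x⇒x<y (<-≤-trans (x<y⇒0<y-x (∣x∣<⇒-x< (close x x≉a near)))
          (≤.reflexive (solve 3 (λ g m D → g :- m :- (:- (D :- g)) := D :- m) refl (to f′ a) m D))))
        right : value a ≤ value x → m * d ≤ to f x - to f a
        right a≤x = ≤.trans (*-monoʳ-≤ (x≤y⇒0≤y-x a≤x) m≤D) (≤.reflexive Dd≈)
        left : value x ≤ value a → m * (value a - value x) ≤ to f a - to f x
        left x≤a = begin
          m * (value a - value x)    ≤⟨ *-monoʳ-≤ (x≤y⇒0≤y-x x≤a) m≤D ⟩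
          D * (value a - value x)    ≈⟨ solve 3 (λ D a x → D :* (a :- x) := :- (D :* (x :- a))) refl
                                          D (value a) (value x) ⟩
          - (D * d)                  ≈⟨ -‿cong Dd≈ ⟩
          - (to f x - to f a)        ≈⟨ solve 2 (λ x a → :- (x :- a) := a :- x) refl (to f x) (to f a) ⟩
          to f a - to f x            ∎

    module _ (a b : Pos) (a≤b : value a ≤ value b)
             {m} (m<f′ : ∀ x → value a ≤ value x → value x ≤ value b → m < to f′ x) where

      Grows : Pos → Set
      Grows x = m * (value x - value a) ≤ to f x - to f a

      grows-trans : ∀ x y → Grows x → m * (value y - value x) ≤ to f y - to f x → Grows y
      grows-trans x y gx xy = begin
        m * (value y - value a)                              ≈⟨ solve 4 (λ m x y a → m :* (y :- a) :=
            m :* (x :- a) :+ m :* (y :- x)) refl m (value x) (value y) (value a) ⟩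
        m * (value x - value a) + m * (value y - value x)    ≤⟨ +-mono-≤ gx xy ⟩
        to f x - to f a + (to f y - to f x)                  ≈⟨ solve 3 (λ x y a → x :- a :+ (y :- x) := y :- a)
                                                                  refl (to f x) (to f y) (to f a) ⟩
        to f y - to f a                                      ∎

      -- Only the end point has to satisfy `Grows`, not the whole interval up to it; this suffices
      -- because `slope-near` acts on both sides of the supremum.
      Reached : Carrier → Set
      Reached x = ∃ λ p → value p ≈ x × value a ≤ value p × value p ≤ value b × Grows p

      grows-refl : Grows a
      grows-refl = ≤.reflexive (solve 3 (λ m a y → m :* (a :- a) := y :- y) refl m (value a) (to f a))

      -- The slope at `s` is used twice. Its left half carries growth from a reached point within δ
      -- of `s` up to `s`; its right half carries it beyond. If `b` were at distance δ or more, a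
      -- reached point above `s` would contradict the supremum, so `b` is closer and the right half
      -- ends at `b` itself.
      module AtSupremum (s : Pos) {δ} (0<δ : 0# < δ) (slope : SlopeNear m s δ)
                        (Reached≤s : UpperBound Reached (value s))
                        (least : ∀ u → UpperBound Reached u → value s ≤ u)
                        (a≤s : value a ≤ value s) (s≤b : value s ≤ value b) where

        s-δ<s : value s - δ < value s
        s-δ<s = 0<y-x⇒x<y (<-≤-trans 0<δ
          (≤.reflexive (solve 2 (λ s d → d := s :- (s :- d)) refl (value s) δ)))

        ∃-near : ∃ λ p → value s - δ < value p × Reached (value p)
        ∃-near with lem {∃ λ p → value s - δ < value p × Reached (value p)}
        ... | yes near = near
        ... | no  none = contradiction
          (least (value s - δ) λ { x (p , p≈x , r) → ≤.trans (≤.reflexive (sym p≈x)) (p≤s-δ p (p , refl , r)) })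
          (<⇒≱ s-δ<s)
          where
          p≤s-δ : ∀ p → Reached (value p) → value p ≤ value s - δ
          p≤s-δ p r with ≤-or-> (value p) (value s - δ)
          ... | inj₁ le = le
          ... | inj₂ gt = contradiction (p , gt , r) none

        near-below : ∀ {q} → q ≤ value s → value s - δ < q → ∣ q - value s ∣ < δ
        near-below {q} q≤s s-δ<q = ∣x∣<-intro
          (begin-strict
            q - value s   ≤⟨ x≤y+z⇒x-z≤y (≤.trans q≤s (≤.reflexive (sym (+-identityˡ (value s))))) ⟩
            0#            <⟨ 0<δ ⟩
            δ             ∎)
          (0<y-x⇒x<y (<-≤-trans (x<y⇒0<y-x s-δ<q)
            (≤.reflexive (solve 3 (λ q s d → q :- (s :- d) := d :- (:- (q :- s))) refl q (value s) δ))))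

        near-above : ∀ {q} → value s ≤ q → q - value s < δ → ∣ q - value s ∣ < δ
        near-above {q} s≤q q-s<δ = ∣x∣<-intro q-s<δ (begin-strict
          - (q - value s)   ≤⟨ -‿nonPos (x≤y⇒0≤y-x s≤q) ⟩
          0#                <⟨ 0<δ ⟩
          δ                 ∎)

        grows-s : Grows s
        grows-s = from-near ∃-near
          where
          from-near : (∃ λ p → value s - δ < value p × Reached (value p)) → Grows s
          from-near (p , s-δ<p , r@(q , q≈p , a≤q , q≤b , gq)) = grows-trans q s gq
            (proj₂ (slope q (near-below q≤s (<-≤-trans s-δ<p (≤.reflexive (sym q≈p))))) q≤s)
            where
            q≤s : value q ≤ value s
            q≤s = ≤.trans (≤.reflexive q≈p) (Reached≤s _ r)

        step-beyond : ∀ {η} → 0# < η → η < δ → ¬ value s + η ≤ value b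
        step-beyond {η} 0<η η<δ x≤b = <⇒≱ s<x
          (Reached≤s (value s + η) (x , refl , ≤.trans a≤s (proj₁ s<x) , x≤b ,
            grows-trans s x grows-s (proj₁ (slope x (near-above (proj₁ s<x)
              (begin-strict value s + η - value s ≈⟨ s+η-s ⟩ η <⟨ η<δ ⟩ δ ∎))) (proj₁ s<x))))
          where
          s+η-s : value s + η - value s ≈ η
          s+η-s = solve 2 (λ s h → s :+ h :- s := h) refl (value s) η
          s<x : value s < value s + η
          s<x = 0<y-x⇒x<y (<-≤-trans 0<η (≤.reflexive (sym s+η-s)))
          x : Pos
          x = value s + η , <-≤-trans (proj₂ s) (proj₁ s<x)

        grows-b : Grows b
        grows-b with ≤-or-> δ (value b - value s)
        ... | inj₂ b-s<δ = grows-trans s b grows-s (proj₁ (slope b (near-above s≤b b-s<δ)) s≤b)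
        ... | inj₁ δ≤b-s = from-half (0<⇒∃half 0<δ)
          where
          from-half : (∃ λ η → 0# < η × η < δ) → Grows b
          from-half (η , 0<η , η<δ) = contradiction
            (begin
              value s + η                     ≤⟨ +-monoʳ-≤ (value s) (≤.trans (proj₁ η<δ) δ≤b-s) ⟩
              value s + (value b - value s)   ≈⟨ solve 2 (λ s b → s :+ (b :- s) := b) refl (value s) (value b) ⟩
              value b                         ∎)
            (step-beyond 0<η η<δ)

      Reached≤b : UpperBound Reached (value b)
      Reached≤b x (p , p≈x , _ , p≤b , _) = ≤.trans (≤.reflexive (sym p≈x)) p≤b

      a-reached : Reached (value a)
      a-reached = a , refl , ≤.refl , a≤b , grows-refl

      increment-≥-strict : Grows b
      increment-≥-strict = conclude (supremum Reached (value a , a-reached) (value b , Reached≤b))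
        where
        conclude : (∃ λ s → UpperBound Reached s × (∀ u → UpperBound Reached u → s ≤ u)) → Grows b
        conclude (s , Reached≤s , least) = at-s (slope-near s⁺ (m<f′ s⁺ a≤s s≤b))
          where
          a≤s : value a ≤ s
          a≤s = Reached≤s _ a-reached
          s≤b : s ≤ value b
          s≤b = least (value b) Reached≤b
          s⁺ : Pos
          s⁺ = s , <-≤-trans (proj₂ a) a≤s
          at-s : (∃ λ δ → 0# < δ × SlopeNear m s⁺ δ) → Grows b
          at-s (δ , 0<δ , slope) = AtSupremum.grows-b s⁺ 0<δ slope Reached≤s least a≤s s≤b

    -- The derivative controls secants only for slopes strictly below its value, so the strict
    -- version is applied to every `m` below `c`; dividing by the length isolates the slope for
    -- `≤-from-below`.
    increment-≥ : ∀ a b {c} → value a < value b →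
                  (∀ x → value a ≤ value x → value x ≤ value b → c ≤ to f′ x) →
                  c * (value b - value a) ≤ to f b - to f a
    increment-≥ a b {c} a<b c≤f′ = begin
      c * L              ≤⟨ *-monoʳ-≤ (proj₁ 0<L) (≤-from-below λ m m<c → *-cancelʳ-≤ 0<L (begin
                              m * L            ≤⟨ increment-≥-strict a b (proj₁ a<b)
                                                    (λ x a≤x x≤b → <-≤-trans m<c (c≤f′ x a≤x x≤b)) ⟩
                              F                ≈⟨ ⁻¹-*-cancel F 0<L ⟨
                              F * L ⁻¹ * L     ∎)) ⟩
      F * L ⁻¹ * L       ≈⟨ ⁻¹-*-cancel F 0<L ⟩
      F                  ∎
      where
      L = value b - value a
      F = to f b - to f a
      0<L : 0# < L
      0<L = x<y⇒0<y-x a<b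

-- Finite sums over lists and index ranges.

module Summation (ℝ : CompleteOrderedField) where
  open CompleteOrderedField ℝ
  open OrderedField ℝ
  open IntegerSolver commutativeRing
  open ≤-Reasoning

  module _ {A : Set} where

    Σ-++ : ∀ (f : A → Carrier) xs ys → Σ[ map f (xs ++ ys) ] ≈ Σ[ map f xs ] + Σ[ map f ys ]
    Σ-++ f []       ys = sym (+-identityˡ _)
    Σ-++ f (x ∷ xs) ys = trans (+-congˡ (Σ-++ f xs ys)) (sym (+-assoc _ _ _))

    Σ-mono-≤ : ∀ {f g : A → Carrier} xs → (∀ {x} → x ∈ xs → f x ≤ g x) → Σ[ map f xs ] ≤ Σ[ map g xs ]
    Σ-mono-≤ []       f≤g = ≤.refl
    Σ-mono-≤ (x ∷ xs) f≤g = +-mono-≤ (f≤g (here ≡.refl)) (Σ-mono-≤ xs (f≤g ∘ there))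

    Σ-cong : ∀ {f g : A → Carrier} xs → (∀ {x} → x ∈ xs → f x ≈ g x) → Σ[ map f xs ] ≈ Σ[ map g xs ]
    Σ-cong []       f≈g = refl
    Σ-cong (x ∷ xs) f≈g = +-cong (f≈g (here ≡.refl)) (Σ-cong xs (f≈g ∘ there))

    Σ-linear : ∀ a b (f g : A → Carrier) xs →
               Σ[ map (λ x → a * f x + b * g x) xs ] ≈ a * Σ[ map f xs ] + b * Σ[ map g xs ]
    Σ-linear a b f g []       = solve 2 (λ a b → con (+ 0) := a :* con (+ 0) :+ b :* con (+ 0)) refl a b
    Σ-linear a b f g (x ∷ xs) = trans (+-congˡ (Σ-linear a b f g xs))
      (solve 6 (λ a b p q s t → a :* p :+ b :* q :+ (a :* s :+ b :* t) := a :* (p :+ s) :+ b :* (q :+ t))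
        refl a b (f x) (g x) Σ[ map f xs ] Σ[ map g xs ])

    Σ-*ˡ : ∀ a (f : A → Carrier) xs → Σ[ map (λ x → a * f x) xs ] ≈ a * Σ[ map f xs ]
    Σ-*ˡ a f []       = sym (zeroʳ a)
    Σ-*ˡ a f (x ∷ xs) = trans (+-congˡ (Σ-*ˡ a f xs)) (sym (distribˡ a _ _))

  Σ-concatMap : ∀ {A B : Set} (f : B → Carrier) (F : A → List B) xs →
                Σ[ map f (concatMap F xs) ] ≈ Σ[ map (λ x → Σ[ map f (F x) ]) xs ]
  Σ-concatMap f F []       = refl
  Σ-concatMap f F (x ∷ xs) = trans (Σ-++ f (F x) (concatMap F xs)) (+-congˡ (Σ-concatMap f F xs))

  Σ-cartesianProductWith : ∀ {A B C : Set} (f : C → Carrier) (h : A → B → C) xs ys →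
    Σ[ map f (cartesianProductWith h xs ys) ] ≈ Σ[ map (λ x → Σ[ map (λ y → f (h x y)) ys ]) xs ]
  Σ-cartesianProductWith f h []       ys = refl
  Σ-cartesianProductWith f h (x ∷ xs) ys = trans
    (Σ-++ f (map (h x) ys) (cartesianProductWith h xs ys))
    (+-cong (reflexive (≡.cong Σ[_] (≡.sym (map-∘ ys)))) (Σ-cartesianProductWith f h xs ys))

  ∑ : ℕ → (ℕ → Carrier) → Carrier
  ∑ n f = Σ[ applyUpTo f n ]

  Σ-upTo : ∀ f n → Σ[ map f (upTo n) ] ≈ ∑ n f
  Σ-upTo f n = reflexive (≡.cong Σ[_] (map-upTo f n))

  ∑-mono-≤ : ∀ {f g} n → (∀ i → i ℕ.< n → f i ≤ g i) → ∑ n f ≤ ∑ n g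
  ∑-mono-≤ zero    f≤g = ≤.refl
  ∑-mono-≤ (suc n) f≤g = +-mono-≤ (f≤g 0 (s≤s z≤n)) (∑-mono-≤ n λ i i<n → f≤g (suc i) (s≤s i<n))

  ∑-cong : ∀ {f g} n → (∀ i → i ℕ.< n → f i ≈ g i) → ∑ n f ≈ ∑ n g
  ∑-cong zero    f≈g = refl
  ∑-cong (suc n) f≈g = +-cong (f≈g 0 (s≤s z≤n)) (∑-cong n λ i i<n → f≈g (suc i) (s≤s i<n))

  ∑-+ : ∀ f g n → ∑ n (λ i → f i + g i) ≈ ∑ n f + ∑ n g
  ∑-+ f g zero    = sym (+-identityˡ 0#)
  ∑-+ f g (suc n) = trans (+-congˡ (∑-+ (f ∘ suc) (g ∘ suc) n))
    (solve 4 (λ a b c d → a :+ b :+ (c :+ d) := a :+ c :+ (b :+ d)) refl _ _ _ _)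

  ∑-*ˡ : ∀ a f n → ∑ n (λ i → a * f i) ≈ a * ∑ n f
  ∑-*ˡ a f zero    = sym (zeroʳ a)
  ∑-*ˡ a f (suc n) = trans (+-congˡ (∑-*ˡ a (f ∘ suc) n)) (sym (distribˡ a _ _))

  ∑-const : ∀ a n → ∑ n (λ _ → a) ≈ fromℕ n * a
  ∑-const a zero    = sym (zeroˡ a)
  ∑-const a (suc n) = trans (+-congˡ (∑-const a n)) (solve 2 (λ a c → a :+ c :* a := (𝟙 :+ c) :* a) refl a (fromℕ n))

  ∑-last : ∀ f n → ∑ (suc n) f ≈ ∑ n f + f n
  ∑-last f zero    = +-comm _ _
  ∑-last f (suc n) = trans (+-congˡ (∑-last (f ∘ suc) n)) (sym (+-assoc _ _ _))

  ∑-reverse : ∀ f m → ∑ (suc m) (λ i → f (m ℕ.∸ i)) ≈ ∑ (suc m) f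
  ∑-reverse f zero    = refl
  ∑-reverse f (suc m) = begin-equality
    f (suc m) + ∑ (suc m) (λ i → f (m ℕ.∸ i))   ≈⟨ +-congˡ (∑-reverse f m) ⟩
    f (suc m) + ∑ (suc m) f                     ≈⟨ +-comm _ _ ⟩
    ∑ (suc m) f + f (suc m)                     ≈⟨ ∑-last f (suc m) ⟨
    ∑ (suc (suc m)) f                           ∎

  -- Reindexing by i ↦ m - i, which lets the terms of right subtrees be collected with those of left
  -- subtrees.
  ∑-swap : ∀ (F : ℕ → ℕ → Carrier) m → ∑ (suc m) (λ i → F i (m ℕ.∸ i)) ≈ ∑ (suc m) (λ i → F (m ℕ.∸ i) i)
  ∑-swap F m = begin-equality
    ∑ (suc m) (λ i → F i (m ℕ.∸ i))
      ≈⟨ ∑-cong (suc m) (λ { i (s≤s i≤m) →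
           reflexive (≡.cong (λ j → F j (m ℕ.∸ i)) (≡.sym (ℕ.m∸[m∸n]≡n i≤m))) }) ⟩
    ∑ (suc m) (λ i → F (m ℕ.∸ (m ℕ.∸ i)) (m ℕ.∸ i))
      ≈⟨ ∑-reverse (λ i → F (m ℕ.∸ i) i) m ⟩
    ∑ (suc m) (λ i → F (m ℕ.∸ i) i)
      ∎

-- Probabilities and expectations over the trees of one size.

module TreeSums (ℝ : CompleteOrderedField) {σ : ℕ → ℕ → CompleteOrderedField.Carrier ℝ}
                (σ-source : Sources.IsSource ℝ σ) where
  open CompleteOrderedField ℝ
  open Sources ℝ
  open OrderedField ℝ
  open Summation ℝ
  open IntegerSolver commutativeRing
  open IsSource σ-source
  open ≤-Reasoning

  P-nonNeg : ∀ t → 0# ≤ P σ t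
  P-nonNeg leaf       = 0≤1
  P-nonNeg (node l r) = *-nonNeg (*-nonNeg (nonNeg (size l) (size r)) (P-nonNeg l)) (P-nonNeg r)
    where
    instance
      _ = ℕ.>-nonZero (size>0 l)
      _ = ℕ.>-nonZero (size>0 r)

  mass : List Tree → Carrier
  mass ts = Σ[ map (P σ) ts ]

  -- On `𝒯 n` with n ≥ 1, whose `mass` is 1, this is the expectation of `w`.
  weight : (Tree → Carrier) → List Tree → Carrier
  weight w ts = Σ[ map (λ t → P σ t * w t) ts ]

  module _ {a b xs ys} (xs-size : ∀ {t} → t ∈ xs → size t ≡ a) (ys-size : ∀ {t} → t ∈ ys → size t ≡ b) where

    P-node : ∀ {l r} → l ∈ xs → r ∈ ys → P σ (node l r) ≈ σ a b * P σ l * P σ r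
    P-node {l} {r} l∈ r∈ = reflexive (≡.cong₂ (λ i j → σ i j * P σ l * P σ r) (xs-size l∈) (ys-size r∈))

    mass-node : mass (cartesianProductWith node xs ys) ≈ σ a b * mass xs * mass ys
    mass-node = begin-equality
      mass (cartesianProductWith node xs ys)
        ≈⟨ Σ-cartesianProductWith (P σ) node xs ys ⟩
      Σ[ map (λ l → Σ[ map (λ r → P σ (node l r)) ys ]) xs ]
        ≈⟨ Σ-cong xs (λ {l} l∈ → begin-equality
             Σ[ map (λ r → P σ (node l r)) ys ]       ≈⟨ Σ-cong ys (P-node l∈) ⟩
             Σ[ map (λ r → σ a b * P σ l * P σ r) ys ] ≈⟨ Σ-*ˡ _ (P σ) ys ⟩
             σ a b * P σ l * mass ys                  ≈⟨ solve 3 (λ s p m → s :* p :* m := s :* m :* p) refl _ _ _ ⟩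
             σ a b * mass ys * P σ l                  ∎) ⟩
      Σ[ map (λ l → σ a b * mass ys * P σ l) xs ]
        ≈⟨ Σ-*ˡ _ (P σ) xs ⟩
      σ a b * mass ys * mass xs
        ≈⟨ solve 3 (λ s p m → s :* p :* m := s :* m :* p) refl _ _ _ ⟩
      σ a b * mass xs * mass ys
        ∎

    -- Given their sizes, the two subtrees are independent: in the term with `w l` the right factor
    -- sums to `mass ys`, in the term with `w r` the left one sums to `mass xs`, and both are 1.
    weight-node : ∀ {w c} → (∀ l r → w (node l r) ≤ c * (w l + w r)) → mass xs ≈ 1# → mass ys ≈ 1# →
                  weight w (cartesianProductWith node xs ys) ≤ σ a b * (c * (weight w xs + weight w ys))
    weight-node {w} {c} w-node mass-xs mass-ys = begin
      weight w (cartesianProductWith node xs ys)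
        ≈⟨ Σ-cartesianProductWith (λ t → P σ t * w t) node xs ys ⟩
      Σ[ map (λ l → Σ[ map (λ r → P σ (node l r) * w (node l r)) ys ]) xs ]
        ≤⟨ Σ-mono-≤ xs (λ {l} l∈ → begin
             Σ[ map (λ r → P σ (node l r) * w (node l r)) ys ]
               ≤⟨ Σ-mono-≤ ys (λ {r} r∈ → begin
                    P σ (node l r) * w (node l r)        ≤⟨ *-monoˡ-≤ (P-nonNeg (node l r)) (w-node l r) ⟩
                    P σ (node l r) * (c * (w l + w r))   ≈⟨ *-congʳ (P-node l∈ r∈) ⟩
                    s * P σ l * P σ r * (c * (w l + w r)) ≈⟨ solve 6 (λ s p q c u v →
                        s :* p :* q :* (c :* (u :+ v)) := s :* c :* (p :* u) :* q :+ s :* c :* p :* (q :* v))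
                        refl s (P σ l) (P σ r) c (w l) (w r) ⟩
                    s * c * (P σ l * w l) * P σ r + s * c * P σ l * (P σ r * w r) ∎) ⟩
             Σ[ map (λ r → s * c * (P σ l * w l) * P σ r + s * c * P σ l * (P σ r * w r)) ys ]
               ≈⟨ Σ-linear _ _ (P σ) (λ r → P σ r * w r) ys ⟩
             s * c * (P σ l * w l) * mass ys + s * c * P σ l * weight w ys
               ≈⟨ +-congʳ (trans (*-congˡ mass-ys) (*-identityʳ _)) ⟩
             s * c * (P σ l * w l) + s * c * P σ l * weight w ys
               ≈⟨ solve 4 (λ k x p y → k :* x :+ k :* p :* y := k :* y :* p :+ k :* x)
                    refl (s * c) (P σ l * w l) (P σ l) (weight w ys) ⟩
             s * c * weight w ys * P σ l + s * c * (P σ l * w l)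
               ∎) ⟩
      Σ[ map (λ l → s * c * weight w ys * P σ l + s * c * (P σ l * w l)) xs ]
        ≈⟨ Σ-linear _ _ (P σ) (λ l → P σ l * w l) xs ⟩
      s * c * weight w ys * mass xs + s * c * weight w xs
        ≈⟨ +-congʳ (trans (*-congˡ mass-xs) (*-identityʳ _)) ⟩
      s * c * weight w ys + s * c * weight w xs
        ≈⟨ solve 4 (λ s c x y → s :* c :* y :+ s :* c :* x := s :* (c :* (x :+ y))) refl s c (weight w xs) (weight w ys) ⟩
      s * (c * (weight w xs + weight w ys))
        ∎
      where s = σ a b

  -- `enum` gives the size of the right subtree as a difference, whereas `nonNeg` and the sequences
  -- shifted by one need a visible successor.
  right-size : ∀ {m i} → i ℕ.< suc m → suc m ℕ.∸ i ≡ suc (m ℕ.∸ i)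
  right-size (s≤s i≤m) = ℕ.+-∸-assoc 1 i≤m

  ∑-σ : ∀ m → ∑ (suc m) (λ i → σ (suc i) (suc m ℕ.∸ i)) ≈ 1#
  ∑-σ m = trans
    (reflexive (≡.cong Σ[_] (≡.sym (map-applyUpTo suc (λ i → σ i (suc (suc m) ℕ.∸ i)) (suc m)))))
    (total (suc (suc m)) (s≤s (s≤s z≤n)))

  joined : ℕ → ℕ → ℕ → List Tree
  joined f m i = cartesianProductWith node (enum f (suc i)) (enum f (suc m ℕ.∸ i))

  mass-enum : ∀ f n → 1 ℕ.≤ n → n ℕ.≤ f → mass (enum f n) ≈ 1#
  mass-enum (suc f) (suc zero)    _ _ = +-identityʳ 1#
  mass-enum (suc f) (suc (suc m)) _ (s≤s n≤f) = begin-equality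
    mass (enum (suc f) (suc (suc m)))
      ≈⟨ Σ-concatMap (P σ) (joined f m) (upTo (suc m)) ⟩
    Σ[ map (λ i → mass (joined f m i)) (upTo (suc m)) ]
      ≈⟨ Σ-upTo _ (suc m) ⟩
    ∑ (suc m) (λ i → mass (joined f m i))
      ≈⟨ ∑-cong (suc m) (λ i i<n → begin-equality
           mass (joined f m i)
             ≈⟨ mass-node (enum-sound f (suc i)) (enum-sound f (suc m ℕ.∸ i)) ⟩
           σ (suc i) (suc m ℕ.∸ i) * mass (enum f (suc i)) * mass (enum f (suc m ℕ.∸ i))
             ≈⟨ *-cong (*-congˡ (mass-enum f (suc i) (s≤s z≤n) (ℕ.≤-trans i<n n≤f)))
                       (mass-enum f (suc m ℕ.∸ i) (ℕ.m<n⇒0<n∸m i<n) (ℕ.≤-trans (ℕ.m∸n≤m (suc m) i) n≤f)) ⟩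
           σ (suc i) (suc m ℕ.∸ i) * 1# * 1#
             ≈⟨ trans (*-identityʳ _) (*-identityʳ _) ⟩
           σ (suc i) (suc m ℕ.∸ i)
             ∎) ⟩
    ∑ (suc m) (λ i → σ (suc i) (suc m ℕ.∸ i))
      ≈⟨ ∑-σ m ⟩
    1#
      ∎

  weight-enum-≤ : ∀ {w c} → (∀ l r → w (node l r) ≤ c * (w l + w r)) → ∀ f m → suc m ℕ.≤ f →
    weight w (enum (suc f) (suc (suc m))) ≤
    ∑ (suc m) (λ i → σ (suc i) (suc m ℕ.∸ i) * (c * (weight w (enum f (suc i)) + weight w (enum f (suc m ℕ.∸ i)))))
  weight-enum-≤ {w} {c} w-node f m n≤f = begin
    weight w (enum (suc f) (suc (suc m)))
      ≈⟨ Σ-concatMap (λ t → P σ t * w t) (joined f m) (upTo (suc m)) ⟩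
    Σ[ map (λ i → weight w (joined f m i)) (upTo (suc m)) ]
      ≈⟨ Σ-upTo _ (suc m) ⟩
    ∑ (suc m) (λ i → weight w (joined f m i))
      ≤⟨ ∑-mono-≤ (suc m) (λ i i<n → weight-node {xs = enum f (suc i)} {ys = enum f (suc m ℕ.∸ i)}
           (enum-sound f (suc i)) (enum-sound f (suc m ℕ.∸ i)) w-node
           (mass-enum f (suc i) (s≤s z≤n) (ℕ.≤-trans i<n n≤f))
           (mass-enum f (suc m ℕ.∸ i) (ℕ.m<n⇒0<n∸m i<n) (ℕ.≤-trans (ℕ.m∸n≤m (suc m) i) n≤f))) ⟩
    ∑ (suc m) (λ i → σ (suc i) (suc m ℕ.∸ i) * (c * (weight w (enum f (suc i)) + weight w (enum f (suc m ℕ.∸ i)))))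
      ∎

  height≤size : ∀ t → height t ℕ.≤ size t
  height≤size leaf       = z≤n
  height≤size (node l r) = ℕ.≤-trans (s≤s (ℕ.⊔-mono-≤ (height≤size l) (height≤size r)))
                             (⊔<+ (size>0 l) (size>0 r))
    where
    ⊔<+ : ∀ {m n} → 0 ℕ.< m → 0 ℕ.< n → m ℕ.⊔ n ℕ.< m ℕ.+ n
    ⊔<+ {m} {n} 0<m 0<n = ℕ.⊔-pres-<m (ℕ.m<m+n m 0<n) (ℕ.m<n+m n 0<m)

-- The recursion for the exponential moment and the growth of ϑ′.

module UpperBoundedSource (ℝ : CompleteOrderedField) where
  open CompleteOrderedField ℝ
  open Sources ℝ
  open OrderedField ℝ
  open Summation ℝ
  open IntegerSolver commutativeRing
  open ≤-Reasoning

  module Moment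
    {ψ N σ} (σ-bounded : IsUpperBoundedSource ψ N σ) (0≤ψ : ∀ n → 0# ≤ ψ (suc n))
    {c} (1≤c : 1# ≤ c)
    -- τ i and θ i stand for ϑ′ (i + 1) and ϑ (i + 1).
    {τ θ : ℕ → Carrier} (1≤τ : ∀ i → 1# ≤ τ i) (τ-mono : ∀ i → τ i ≤ τ (suc i))
    (0≤θ : ∀ i → 0# ≤ θ i) (τ≤Δθ : ∀ i → τ i + θ i ≤ θ (suc i))
    (cψθ≤τ : ∀ i → N ℕ.≤ suc i → c * ψ (suc i) * θ i ≤ τ i)
    where
    open IsUpperBoundedSource σ-bounded
    open IsSource isSource
    open TreeSums ℝ isSource

    0≤c : 0# ≤ c
    0≤c = ≤.trans 0≤1 1≤c

    ∑τ≤θ : ∀ n → ∑ n τ ≤ θ n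
    ∑τ≤θ zero    = 0≤θ 0
    ∑τ≤θ (suc n) = begin
      ∑ (suc n) τ   ≈⟨ ∑-last τ n ⟩
      ∑ n τ + τ n   ≤⟨ +-monoˡ-≤ (τ n) (∑τ≤θ n) ⟩
      θ n + τ n     ≈⟨ +-comm _ _ ⟩
      τ n + θ n     ≤⟨ τ≤Δθ n ⟩
      θ (suc n)     ∎

    c^height : Tree → Carrier
    c^height t = c ^ height t

    c^height-node : ∀ l r → c^height (node l r) ≤ c * (c^height l + c^height r)
    c^height-node l r = *-monoˡ-≤ 0≤c c^max
      where
      c^max : c ^ (height l ℕ.⊔ height r) ≤ c^height l + c^height r
      c^max with ℕ.⊔-sel (height l) (height r)
      ... | inj₁ eq = ≤-gap (^-nonNeg 0≤c (height r)) (+-congʳ (reflexive (≡.cong (c ^_) (≡.sym eq))))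
      ... | inj₂ eq = ≤-gap (^-nonNeg 0≤c (height l))
                        (trans (+-comm _ _) (+-congʳ (reflexive (≡.cong (c ^_) (≡.sym eq)))))

    pair-≤ψ : ∀ {m i} → N ℕ.≤ suc (suc m) → i ℕ.< suc m →
              σ (suc i) (suc (m ℕ.∸ i)) + σ (suc (m ℕ.∸ i)) (suc i) ≤ ψ (suc (suc m))
    pair-≤ψ {m} {i} N≤n i<n = ≡.subst (λ j → σ (suc i) j + σ j (suc i) ≤ ψ (suc (suc m)))
      (right-size i<n) (bounded (suc (suc m)) (suc i) N≤n (s≤s z≤n) (s≤s i<n))

    -- Each `u i` occurs once for a left and once for a right subtree of size i + 1. After `∑-swap`
    -- its coefficient is the symmetric sum of two values of σ, which is exactly the quantity that ψ
    -- bounds.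
    pairs-≤ : ∀ m (u : ℕ → Carrier) → N ℕ.≤ suc (suc m) → (∀ i → 0# ≤ u i) →
              ∑ (suc m) (λ i → σ (suc i) (suc (m ℕ.∸ i)) * (u i + u (m ℕ.∸ i))) ≤ ψ (suc (suc m)) * ∑ (suc m) u
    pairs-≤ m u N≤n 0≤u = begin
      ∑ (suc m) (λ i → s i * (u i + u (m ℕ.∸ i)))
        ≈⟨ ∑-cong (suc m) (λ i _ → distribˡ (s i) (u i) (u (m ℕ.∸ i))) ⟩
      ∑ (suc m) (λ i → s i * u i + s i * u (m ℕ.∸ i))
        ≈⟨ ∑-+ (λ i → s i * u i) (λ i → s i * u (m ℕ.∸ i)) (suc m) ⟩
      ∑ (suc m) (λ i → s i * u i) + ∑ (suc m) (λ i → s i * u (m ℕ.∸ i))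
        ≈⟨ +-congˡ (∑-swap (λ i j → σ (suc i) (suc j) * u j) m) ⟩
      ∑ (suc m) (λ i → s i * u i) + ∑ (suc m) (λ i → s′ i * u i)
        ≈⟨ ∑-+ (λ i → s i * u i) (λ i → s′ i * u i) (suc m) ⟨
      ∑ (suc m) (λ i → s i * u i + s′ i * u i)
        ≤⟨ ∑-mono-≤ (suc m) (λ i i<n → ≤.trans (≤.reflexive (sym (distribʳ _ _ _)))
             (*-monoʳ-≤ (0≤u i) (pair-≤ψ N≤n i<n))) ⟩
      ∑ (suc m) (λ i → ψ (suc (suc m)) * u i)
        ≈⟨ ∑-*ˡ _ u (suc m) ⟩
      ψ (suc (suc m)) * ∑ (suc m) u
        ∎
      where
      s s′ : ℕ → Carrier
      s i  = σ (suc i) (suc (m ℕ.∸ i))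
      s′ i = σ (suc (m ℕ.∸ i)) (suc i)

    -- `pairs-≤` with `u` constantly 1: every value of σ at this size is then counted with factor 2,
    -- and these values sum to 1.
    2≤[n-1]ψ : ∀ m → N ℕ.≤ suc (suc m) → 1# + 1# ≤ fromℕ (suc m) * ψ (suc (suc m))
    2≤[n-1]ψ m N≤n = begin
      1# + 1#
        ≈⟨ solve 1 (λ x → 𝟙 :+ 𝟙 := 𝟙 :* (𝟙 :+ 𝟙)) refl 1# ⟩
      1# * (1# + 1#)
        ≈⟨ *-congʳ (∑-σ m) ⟨
      ∑ (suc m) (λ i → σ (suc i) (suc m ℕ.∸ i)) * (1# + 1#)
        ≈⟨ *-comm _ _ ⟩
      (1# + 1#) * ∑ (suc m) (λ i → σ (suc i) (suc m ℕ.∸ i))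
        ≈⟨ ∑-*ˡ (1# + 1#) (λ i → σ (suc i) (suc m ℕ.∸ i)) (suc m) ⟨
      ∑ (suc m) (λ i → (1# + 1#) * σ (suc i) (suc m ℕ.∸ i))
        ≈⟨ ∑-cong (suc m) (λ i i<n → trans (*-comm (1# + 1#) (σ (suc i) (suc m ℕ.∸ i)))
             (*-congʳ (reflexive (≡.cong (σ (suc i)) (right-size i<n))))) ⟩
      ∑ (suc m) (λ i → σ (suc i) (suc (m ℕ.∸ i)) * (1# + 1#))
        ≤⟨ pairs-≤ m (λ _ → 1#) N≤n (λ _ → 0≤1) ⟩
      ψ (suc (suc m)) * ∑ (suc m) (λ _ → 1#)
        ≈⟨ *-congˡ (trans (∑-const 1# (suc m)) (*-identityʳ _)) ⟩
      ψ (suc (suc m)) * fromℕ (suc m)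
        ≈⟨ *-comm _ _ ⟩
      fromℕ (suc m) * ψ (suc (suc m))
        ∎

    -- Up to the threshold, height ≤ size ≤ `N` holds for every tree and the total mass is 1; the
    -- constant `c ^ N` comes from here.
    small-moment : ∀ f n → 1 ℕ.≤ n → n ℕ.≤ f → n ℕ.≤ N → weight c^height (enum f n) ≤ c ^ N
    small-moment f n 1≤n n≤f n≤N = begin
      weight c^height (enum f n)
        ≤⟨ Σ-mono-≤ (enum f n) (λ {t} t∈ → begin
             P σ t * c ^ height t   ≤⟨ *-monoˡ-≤ (P-nonNeg t) (^-monoʳ-≤ 1≤c (ℕ.≤-trans (height≤size t)
                                         (ℕ.≤-trans (ℕ.≤-reflexive (enum-sound f n t∈)) n≤N))) ⟩
             P σ t * c ^ N          ≈⟨ *-comm _ _ ⟩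
             c ^ N * P σ t          ∎) ⟩
      Σ[ map (λ t → c ^ N * P σ t) (enum f n) ]
        ≈⟨ Σ-*ˡ _ (P σ) (enum f n) ⟩
      c ^ N * mass (enum f n)
        ≈⟨ trans (*-congˡ (mass-enum f n 1≤n n≤f)) (*-identityʳ _) ⟩
      c ^ N
        ∎

    0≤c^N : 0# ≤ c ^ N
    0≤c^N = ^-nonNeg 0≤c N

    c^N≤c^Nτ : ∀ i → c ^ N ≤ c ^ N * τ i
    c^N≤c^Nτ i = ≤.trans (≤.reflexive (sym (*-identityʳ _))) (*-monoˡ-≤ 0≤c^N (1≤τ i))

    0≤τ : ∀ i → 0# ≤ τ i
    0≤τ i = ≤.trans 0≤1 (1≤τ i)

    -- Stated for every sufficient fuel, since each level lowers the fuel by one while the subtree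
    -- sizes drop by varying amounts. The recursion is linear in the moments, so `c ^ N` factors out
    -- and is carried along unchanged.
    moment-≤ : ∀ f i → i ℕ.< f → weight c^height (enum f (suc i)) ≤ c ^ N * τ i
    moment-≤ (suc f) zero    _ = begin
      1# * 1# + 0#   ≈⟨ trans (+-identityʳ _) (*-identityʳ 1#) ⟩
      1#             ≤⟨ 1≤^ 1≤c N ⟩
      c ^ N          ≤⟨ c^N≤c^Nτ 0 ⟩
      c ^ N * τ 0    ∎
    moment-≤ (suc f) (suc m) (s≤s n≤f) with N ℕ.≤? suc (suc m)
    -- Below the threshold the constant alone is enough, because τ is at least 1.
    ... | no  N≰n = ≤.trans (small-moment (suc f) (suc (suc m)) (s≤s z≤n) (s≤s n≤f) (ℕ.<⇒≤ (ℕ.≰⇒> N≰n)))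
                      (c^N≤c^Nτ (suc m))
    ... | yes N≤n = begin
      weight c^height (enum (suc f) (suc (suc m)))
        ≤⟨ weight-enum-≤ c^height-node f m n≤f ⟩
      ∑ (suc m) (λ i → σ (suc i) (suc m ℕ.∸ i) *
        (c * (weight c^height (enum f (suc i)) + weight c^height (enum f (suc m ℕ.∸ i)))))
        ≈⟨ ∑-cong (suc m) (λ i i<n → reflexive (≡.cong (λ j → σ (suc i) j *
             (c * (weight c^height (enum f (suc i)) + weight c^height (enum f j)))) (right-size i<n))) ⟩
      ∑ (suc m) (λ i → σ (suc i) (suc (m ℕ.∸ i)) *
        (c * (weight c^height (enum f (suc i)) + weight c^height (enum f (suc (m ℕ.∸ i))))))
        ≤⟨ ∑-mono-≤ (suc m) (λ i i<n → *-monoˡ-≤ (nonNeg (suc i) (suc (m ℕ.∸ i))) (*-monoˡ-≤ 0≤c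
             (+-mono-≤ (moment-≤ f i (ℕ.≤-trans i<n n≤f))
                       (moment-≤ f (m ℕ.∸ i) (ℕ.≤-trans (s≤s (ℕ.m∸n≤m m i)) n≤f))))) ⟩
      ∑ (suc m) (λ i → σ (suc i) (suc (m ℕ.∸ i)) * (c * (c ^ N * τ i + c ^ N * τ (m ℕ.∸ i))))
        ≈⟨ ∑-cong (suc m) (λ i _ → solve 5 (λ s c C x y → s :* (c :* (C :* x :+ C :* y)) :=
             c :* C :* (s :* (x :+ y))) refl (σ (suc i) (suc (m ℕ.∸ i))) c (c ^ N) (τ i) (τ (m ℕ.∸ i))) ⟩
      ∑ (suc m) (λ i → c * c ^ N * (σ (suc i) (suc (m ℕ.∸ i)) * (τ i + τ (m ℕ.∸ i))))
        ≈⟨ ∑-*ˡ (c * c ^ N) (λ i → σ (suc i) (suc (m ℕ.∸ i)) * (τ i + τ (m ℕ.∸ i))) (suc m) ⟩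
      c * c ^ N * ∑ (suc m) (λ i → σ (suc i) (suc (m ℕ.∸ i)) * (τ i + τ (m ℕ.∸ i)))
        ≤⟨ *-monoˡ-≤ (*-nonNeg 0≤c 0≤c^N) (≤.trans (pairs-≤ m τ N≤n 0≤τ)
             (*-monoˡ-≤ (0≤ψ (suc m)) (∑τ≤θ (suc m)))) ⟩
      c * c ^ N * (ψ (suc (suc m)) * θ (suc m))
        ≈⟨ solve 4 (λ c C p t → c :* C :* (p :* t) := C :* (c :* p :* t)) refl c (c ^ N) _ _ ⟩
      c ^ N * (c * ψ (suc (suc m)) * θ (suc m))
        ≤⟨ *-monoˡ-≤ 0≤c^N (cψθ≤τ (suc m) N≤n) ⟩
      c ^ N * τ (suc m)
        ∎

    τ-mono-+ : ∀ i k → τ i ≤ τ (k ℕ.+ i)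
    τ-mono-+ i zero    = ≤.refl
    τ-mono-+ i (suc k) = ≤.trans (τ-mono-+ i k) (τ-mono (k ℕ.+ i))

    -- θ is nonnegative at `i`, and each of the next k unit steps raises it by at least `τ i`, as τ
    -- is increasing.
    kτ≤θ : ∀ i k → fromℕ k * τ i ≤ θ (k ℕ.+ i)
    kτ≤θ i zero    = ≤.trans (≤.reflexive (zeroˡ _)) (0≤θ i)
    kτ≤θ i (suc k) = begin
      (1# + fromℕ k) * τ i           ≈⟨ solve 2 (λ k t → (𝟙 :+ k) :* t := t :+ k :* t) refl (fromℕ k) (τ i) ⟩
      τ i + fromℕ k * τ i            ≤⟨ +-mono-≤ (τ-mono-+ i k) (kτ≤θ i k) ⟩
      τ (k ℕ.+ i) + θ (k ℕ.+ i)      ≤⟨ τ≤Δθ (k ℕ.+ i) ⟩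
      θ (suc k ℕ.+ i)                ∎

    module _ (2≤c : 1# + 1# ≤ c) where

      τ-doubles : ∀ i → N ℕ.≤ suc i → (1# + 1#) * τ i ≤ τ (suc i ℕ.+ i)
      τ-doubles i N≤1+i = *-cancelʳ-≤ 0<2k (begin
        2# * τ i * (2# * k)                  ≈⟨ solve 2 (λ t k → (𝟙 :+ 𝟙) :* t :* ((𝟙 :+ 𝟙) :* k) :=
                                                  (𝟙 :+ 𝟙) :* (𝟙 :+ 𝟙) :* (k :* t)) refl (τ i) k ⟩
        2# * 2# * (k * τ i)                  ≤⟨ *-monoˡ-≤ (*-nonNeg 0≤2 0≤2) (kτ≤θ i (suc i)) ⟩
        2# * 2# * θ j                        ≤⟨ *-monoʳ-≤ (0≤θ j) (*-mono-≤ 0≤2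
                                                 (*-nonNeg (fromℕ-nonNeg j) (0≤ψ j)) 2≤c (2≤[n-1]ψ (i ℕ.+ i) N≤n)) ⟩
        c * (fromℕ j * ψ (suc j)) * θ j      ≈⟨ solve 4 (λ c k p t → c :* (k :* p) :* t := c :* p :* t :* k)
                                                  refl _ _ _ _ ⟩
        c * ψ (suc j) * θ j * fromℕ j        ≤⟨ *-mono-≤ (*-nonNeg (*-nonNeg 0≤c (0≤ψ j)) (0≤θ j))
                                                  (*-nonNeg 0≤2 (fromℕ-nonNeg (suc i))) (cψθ≤τ j N≤n) j≤2k ⟩
        τ j * (2# * k)                       ∎)
        where
        2# = 1# + 1#
        0≤2 : 0# ≤ 2#
        0≤2 = +-nonNeg 0≤1 0≤1
        -- With k = i + 1, the index `j` = 2k - 1 stands for the argument 2k, since τ and θ are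
        -- shifted by one. The factor n - 1 of `2≤[n-1]ψ` is then `j`, which is rounded up to 2k so
        -- that 2k cancels on both sides.
        j = suc i ℕ.+ i
        k = fromℕ (suc i)
        N≤n : N ℕ.≤ suc j
        N≤n = ℕ.≤-trans N≤1+i (s≤s (ℕ.m≤n⇒m≤1+n (ℕ.m≤m+n i i)))
        0<2k : 0# < 2# * k
        0<2k = *-pos (1≤⇒0< (x≤1+x 1#)) (0<fromℕ-suc i)
        j≤2k : fromℕ j ≤ 2# * k
        j≤2k = begin
          fromℕ (suc i ℕ.+ i)       ≤⟨ fromℕ-mono-≤ (ℕ.+-monoʳ-≤ (suc i) (ℕ.n≤1+n i)) ⟩
          fromℕ (suc i ℕ.+ suc i)   ≈⟨ fromℕ-+ (suc i) (suc i) ⟩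
          k + k                     ≈⟨ solve 1 (λ k → k :+ k := (𝟙 :+ 𝟙) :* k) refl k ⟩
          2# * k                    ∎

      τ-exponential : ∀ k → ∃ λ i → N ℕ.≤ suc i × (1# + 1#) ^ k ≤ τ i
      -- Starting at `N` keeps every index of the doubling sequence in the range where ψ bounds σ.
      τ-exponential zero    = N , ℕ.n≤1+n N , 1≤τ N
      τ-exponential (suc k) with i , N≤1+i , 2^k≤τ ← τ-exponential k =
        suc i ℕ.+ i , ℕ.≤-trans N≤1+i (s≤s (ℕ.m≤n⇒m≤1+n (ℕ.m≤m+n i i))) ,
        ≤.trans (*-monoˡ-≤ (+-nonNeg 0≤1 0≤1) 2^k≤τ) (τ-doubles i N≤1+i)

      τ-unbounded : ∀ k → ∃ λ i₀ → ∀ i → i₀ ℕ.≤ i → fromℕ k < τ i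
      τ-unbounded k with i₀ , _ , 2^k≤τ ← τ-exponential k = i₀ , λ i i₀≤i → begin-strict
        fromℕ k          <⟨ x<1+x ⟩
        1# + fromℕ k     ≤⟨ 1+k≤2^k k ⟩
        (1# + 1#) ^ k    ≤⟨ 2^k≤τ ⟩
        τ i₀             ≤⟨ τ-mono-+ i₀ (i ℕ.∸ i₀) ⟩
        τ (i ℕ.∸ i₀ ℕ.+ i₀) ≡⟨ ≡.cong τ (ℕ.m∸n+n≡m i₀≤i) ⟩
        τ i              ∎

-- From the exponential moment to the expected height.

module Heights (lem : ExcludedMiddle 0ℓ) (ℝ : CompleteOrderedField)
               {σ : ℕ → ℕ → CompleteOrderedField.Carrier ℝ} (σ-source : Sources.IsSource ℝ σ) where
  open CompleteOrderedField ℝ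
  open Sources ℝ
  open Transcendental lem ℝ
  open OrderedField ℝ
  open Exponential lem ℝ
  open Summation ℝ
  open TreeSums ℝ σ-source
  open Exp commutativeSemiring using (^-homo-*; ^-congʳ)
  open IntegerSolver commutativeRing
  open ≤-Reasoning

  0<e^ : ∀ k → 0# < e ^ k
  0<e^ k = 1≤⇒0< (1≤^ 1≤e k)

  -- For h = k + 1 + j this is 1 + j ≤ e^j, the tangent line of exp at 0 shifted to k + 1. The shift
  -- suits e^k < y ≤ e^(k+1): dividing by the upper end bounds the averaged quotient by the constant
  -- `C`, and the lower end puts k below `ln y`.
  h≤k+e^h/e^[1+k] : ∀ h k → fromℕ h ≤ fromℕ k + e ^ h * (e ^ suc k) ⁻¹
  h≤k+e^h/e^[1+k] h k with ℕ.≤-<-connex h k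
  ... | inj₁ h≤k = ≤.trans (fromℕ-mono-≤ h≤k)
                     (≤-gap (*-nonNeg (^-nonNeg 0≤e h) (⁻¹-nonNeg (0<e^ (suc k)))) refl)
  ... | inj₂ k<h = begin
    fromℕ h                                        ≡⟨ ≡.cong fromℕ (≡.sym h≡) ⟩
    fromℕ (j ℕ.+ suc k)                            ≈⟨ fromℕ-+ j (suc k) ⟩
    fromℕ j + (1# + fromℕ k)                       ≈⟨ solve 2 (λ j k → j :+ (𝟙 :+ k) := k :+ (𝟙 :+ j)) refl
                                                        (fromℕ j) (fromℕ k) ⟩
    fromℕ k + (1# + fromℕ j)                       ≤⟨ +-monoʳ-≤ (fromℕ k) (1+k≤e^k j) ⟩
    fromℕ k + e ^ j                                ≈⟨ +-congˡ (*-⁻¹-cancel (e ^ j) (0<e^ (suc k))) ⟨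
    fromℕ k + e ^ j * e ^ suc k * (e ^ suc k) ⁻¹   ≈⟨ +-congˡ (*-congʳ
                                                        (trans (sym (^-homo-* e j (suc k))) (^-congʳ e h≡))) ⟩
    fromℕ k + e ^ h * (e ^ suc k) ⁻¹               ∎
    where
    j = h ℕ.∸ suc k
    h≡ : j ℕ.+ suc k ≡ h
    h≡ = ℕ.m∸n+n≡m k<h

  -- Jensen's inequality for exp, in which rounding ln y to an integer k is
  -- absorbed by the constant C.
  𝔼H-≤-ln : ∀ {n C y} → 1 ℕ.≤ n → 0# ≤ C → 1# < y → weight (λ t → e ^ height t) (𝒯 n) ≤ C * y →
            𝔼[H n , σ ] ≤ ln y + C
  𝔼H-≤-ln {n} {C} {y} 1≤n 0≤C 1<y moment≤ = from-bracket (e^-bracket 1<y)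
    where
    from-bracket : (∃ λ k → e ^ k < y × y ≤ e ^ suc k) → 𝔼[H n , σ ] ≤ ln y + C
    from-bracket (k , e^k<y , y≤e^1+k) = begin
      𝔼[H n , σ ]
        ≤⟨ Σ-mono-≤ (𝒯 n) (λ {t} _ → begin
             P σ t * fromℕ (height t)                           ≤⟨ *-monoˡ-≤ (P-nonNeg t)
                                                                     (h≤k+e^h/e^[1+k] (height t) k) ⟩
             P σ t * (fromℕ k + e ^ height t * q)               ≈⟨ solve 4 (λ p k w q → p :* (k :+ w :* q) :=
                 k :* p :+ q :* (p :* w)) refl (P σ t) (fromℕ k) (e ^ height t) q ⟩
             fromℕ k * P σ t + q * (P σ t * e ^ height t)       ∎) ⟩
      Σ[ map (λ t → fromℕ k * P σ t + q * (P σ t * e ^ height t)) (𝒯 n) ]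
        ≈⟨ Σ-linear (fromℕ k) q (P σ) (λ t → P σ t * e ^ height t) (𝒯 n) ⟩
      fromℕ k * mass (𝒯 n) + q * weight (λ t → e ^ height t) (𝒯 n)
        ≤⟨ +-mono-≤ (≤.reflexive (trans (*-congˡ (mass-enum n n 1≤n ℕ.≤-refl)) (*-identityʳ _)))
                    (*-monoˡ-≤ 0≤q (≤.trans moment≤ (*-monoˡ-≤ 0≤C y≤e^1+k))) ⟩
      fromℕ k + q * (C * e ^ suc k)
        ≈⟨ +-congˡ (trans (*-comm _ _) (*-⁻¹-cancel C (0<e^ (suc k)))) ⟩
      fromℕ k + C
        ≤⟨ +-monoˡ-≤ C (k≤ln k e^k<y) ⟩
      ln y + C
        ∎
      where
      q = (e ^ suc k) ⁻¹
      0≤q : 0# ≤ q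
      0≤q = ⁻¹-nonNeg (0<e^ (suc k))

-- Absorbing the additive constant into the factor 1 + o(1).

module LogarithmicBound (lem : ExcludedMiddle 0ℓ) (ℝ : CompleteOrderedField) where
  open CompleteOrderedField ℝ
  open Transcendental lem ℝ
  open Asymptotics ℝ
  open OrderedField ℝ
  open Archimedean lem
  open Exponential lem ℝ
  open IntegerSolver commutativeRing
  open ≤-Reasoning

  module _ {τ : ℕ → Carrier} (τ-unbounded : ∀ k → ∃ λ i₀ → ∀ i → i₀ ℕ.≤ i → fromℕ k < τ i)
           {C} (0≤C : 0# ≤ C) where

    ln-unbounded : ∀ k → ∃ λ i₀ → ∀ i → i₀ ℕ.≤ i → fromℕ k ≤ ln (τ i)
    ln-unbounded k = i₀ , λ i i₀≤i → k≤ln k (≤-<-trans (proj₂ (archimedean (e ^ k))) (τ-large i i₀≤i))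
      where
      i₀ = proj₁ (τ-unbounded (proj₁ (archimedean (e ^ k))))
      τ-large = proj₂ (τ-unbounded (proj₁ (archimedean (e ^ k))))

    -- Comes from L + C = L (1 + C / L) with L = ln ϑ′(n); the successor appears because `τ i`
    -- stands for the value of ϑ′ at i + 1.
    error : ℕ → Carrier
    error zero    = 0#
    error (suc i) = C * ln (τ i) ⁻¹

    error-small : ∀ {L ε k} → 0# < ε → C * ε ⁻¹ ≤ fromℕ k → fromℕ (suc k) ≤ L → ∣ C * L ⁻¹ - 0# ∣ < ε
    error-small {L} {ε} {k} 0<ε C/ε≤k 1+k≤L = ∣x∣<-intro
      (begin-strict
        C * L ⁻¹ - 0#     ≈⟨ x-0≈x ⟩
        C * L ⁻¹          <⟨ *-cancelʳ-< (proj₁ 0<L) (begin-strict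
                               C * L ⁻¹ * L         ≈⟨ ⁻¹-*-cancel C 0<L ⟩
                               C                    ≈⟨ ⁻¹-*-cancel C 0<ε ⟨
                               C * ε ⁻¹ * ε         ≤⟨ *-monoʳ-≤ (proj₁ 0<ε) C/ε≤k ⟩
                               -- The spare unit in `suc k` makes the estimate strict.
                               fromℕ k * ε          <⟨ 0<y-x⇒x<y (<-≤-trans 0<ε (≤.reflexive
                                                         (solve 2 (λ k ε → ε := (𝟙 :+ k) :* ε :- k :* ε) refl (fromℕ k) ε))) ⟩
                               fromℕ (suc k) * ε    ≤⟨ *-monoʳ-≤ (proj₁ 0<ε) 1+k≤L ⟩
                               L * ε                ≈⟨ *-comm L ε ⟩
                               ε * L                ∎) ⟩
        ε                 ∎)
      (begin-strict
        - (C * L ⁻¹ - 0#)   ≤⟨ -‿nonPos (≤.trans (*-nonNeg 0≤C (⁻¹-nonNeg 0<L)) (≤.reflexive (sym x-0≈x))) ⟩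
        0#                  <⟨ 0<ε ⟩
        ε                   ∎)
      where
      0<L : 0# < L
      0<L = <-≤-trans (0<fromℕ-suc k) 1+k≤L
      x-0≈x : C * L ⁻¹ - 0# ≈ C * L ⁻¹
      x-0≈x = solve 1 (λ x → x :- con (+ 0) := x) refl (C * L ⁻¹)

    error⟶0 : error ⟶ 0#
    error⟶0 ε 0<ε = suc i₀ , λ { (suc i) (s≤s i₀≤i) →
      error-small {ln (τ i)} {ε} {k} 0<ε (proj₂ (archimedean (C * ε ⁻¹))) (ln-large i i₀≤i) }
      where
      k = proj₁ (archimedean (C * ε ⁻¹))
      i₀ = proj₁ (ln-unbounded (suc k))
      ln-large = proj₂ (ln-unbounded (suc k))

    L+C≈L[1+C/L] : ∀ {L} → 0# < L → L + C ≈ L * (1# + C * L ⁻¹)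
    L+C≈L[1+C/L] {L} 0<L = begin-equality
      L + C                      ≈⟨ +-congˡ (⁻¹-*-cancel C 0<L) ⟨
      L + C * L ⁻¹ * L           ≈⟨ solve 2 (λ L x → L :+ x :* L := L :* (𝟙 :+ x)) refl L (C * L ⁻¹) ⟩
      L * (1# + C * L ⁻¹)        ∎

    ln+C⇒[1+o1] : ∀ {a b : (n : ℕ) .{{_ : NonZero n}} → Carrier} → (∀ i → b (suc i) ≡ ln (τ i)) →
                  (∀ i → 1# < τ i → a (suc i) ≤ ln (τ i) + C) → a ≤ b [1+o1]
    ln+C⇒[1+o1] {a} {b} b≡ln a≤ln+C = error , error⟶0 , suc (i₀ ℕ.⊔ i₁) , bound
      where
      -- `i₀` makes `τ i` exceed 1, as the bound on `a` requires; `i₁` makes its logarithm at least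
      -- 1, so that it can be divided by.
      i₀ = proj₁ (τ-unbounded 1)
      i₁ = proj₁ (ln-unbounded 1)
      bound : ∀ n .{{_ : NonZero n}} → suc (i₀ ℕ.⊔ i₁) ℕ.≤ n → a n ≤ b n * (1# + error n)
      bound (suc i) (s≤s i₀⊔i₁≤i) = begin
        a (suc i)                               ≤⟨ a≤ln+C i 1<τ ⟩
        ln (τ i) + C                            ≈⟨ L+C≈L[1+C/L] (<-≤-trans (0<fromℕ-suc 0)
                                                     (proj₂ (ln-unbounded 1) i (ℕ.m⊔n≤o⇒n≤o i₀ i₁ i₀⊔i₁≤i))) ⟩
        ln (τ i) * (1# + C * ln (τ i) ⁻¹)       ≡⟨ ≡.cong (_* (1# + C * ln (τ i) ⁻¹)) (b≡ln i) ⟨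
        b (suc i) * (1# + error (suc i))        ∎
        where
        1<τ : 1# < τ i
        1<τ = ≤-<-trans (1≤fromℕ-suc 0) (proj₂ (τ-unbounded 1) i (ℕ.m⊔n≤o⇒m≤o i₀ i₁ i₀⊔i₁≤i))

theorem3p3 :
  (lem : ExcludedMiddle 0ℓ) (ℝ : CompleteOrderedField) →
  let open CompleteOrderedField ℝ
      open Transcendental lem ℝ
      open Sources ℝ
      open Asymptotics ℝ
      open Func
  in
  (ψ : ℕ → Carrier) →
  (∀ n .{{_ : NonZero n}} → 0# < ψ n × ψ n ≤ 1#) →
  (∀ m n .{{_ : NonZero m}} .{{_ : NonZero n}} → m ℕ.≤ n → ψ n ≤ ψ m) →
  (N : ℕ) → 1 ℕ.≤ N →
  (σ : ℕ → ℕ → Carrier) → IsUpperBoundedSource ψ N σ →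
  (ϑ ϑ′ : Func ℝ⁺ setoid) →
  IsDerivative ϑ ϑ′ →
  (∀ x → 0# ≤ to ϑ x) →
  ¬ Constant ϑ′ →
  (∀ x y → 1# ≤ value x → value x ≤ value y → to ϑ′ x ≤ to ϑ′ y) →
  (∀ n .{{_ : NonZero n}} → N ℕ.≤ n → e * ψ n * to ϑ (fromℕ⁺ n) ≤ to ϑ′ (fromℕ⁺ n)) →
  1# ≤ to ϑ′ 1⁺ →
  (λ n → 𝔼[H n , σ ]) ≤ (λ n → ln (to ϑ′ (fromℕ⁺ n))) [1+o1]
theorem3p3 lem ℝ ψ ψ-range _ N _ σ σ-bounded ϑ ϑ′ ϑ-derivative 0≤ϑ _ ϑ′-mono eψϑ≤ϑ′ 1≤ϑ′1 =
  -- The additive constant `C` is e^N, inferred from `0≤c^N`.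
  ln+C⇒[1+o1] (τ-unbounded 2≤e) 0≤c^N (λ _ → ≡.refl)
    λ i 1<τ → 𝔼H-≤-ln {suc i} (s≤s z≤n) 0≤c^N 1<τ (moment-≤ (suc i) i ℕ.≤-refl)
  where
  open CompleteOrderedField ℝ
  open Sources ℝ
  open OrderedField ℝ
  open Exponential lem ℝ
  open MeanValue lem ℝ
  open LogarithmicBound lem ℝ
  open IntegerSolver commutativeRing
  open ≤-Reasoning
  open Func

  τ θ : ℕ → Carrier
  τ i = to ϑ′ (fromℕ⁺ (suc i))
  θ i = to ϑ (fromℕ⁺ (suc i))

  1≤τ : ∀ i → 1# ≤ τ i
  1≤τ i = ≤.trans 1≤ϑ′1 (ϑ′-mono 1⁺ (fromℕ⁺ (suc i)) ≤.refl (1≤fromℕ-suc i))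

  τ-mono : ∀ i → τ i ≤ τ (suc i)
  τ-mono i = ϑ′-mono (fromℕ⁺ (suc i)) (fromℕ⁺ (suc (suc i))) (1≤fromℕ-suc i) (x≤1+x (fromℕ (suc i)))

  -- On the interval from i + 1 to i + 2 monotonicity gives ϑ′ ≥ ϑ′(i + 1). The factor 1 + n - n is
  -- the length of the interval in the form in which `increment-≥` states it.
  τ≤Δθ : ∀ i → τ i + θ i ≤ θ (suc i)
  τ≤Δθ i = x≤z-y⇒x+y≤z (begin
    τ i                            ≈⟨ solve 2 (λ t n → t := t :* (𝟙 :+ n :- n)) refl (τ i) (fromℕ (suc i)) ⟩
    τ i * (1# + fromℕ (suc i) - fromℕ (suc i))
                                   ≤⟨ increment-≥ ϑ ϑ′ ϑ-derivative (fromℕ⁺ (suc i)) (fromℕ⁺ (suc (suc i))) x<1+x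
                                        (λ x i≤x _ → ϑ′-mono (fromℕ⁺ (suc i)) x (1≤fromℕ-suc i) i≤x) ⟩
    θ (suc i) - θ i                ∎)

  open UpperBoundedSource.Moment ℝ σ-bounded (λ n → proj₁ (proj₁ (ψ-range (suc n)))) 1≤e
    {τ} {θ} 1≤τ τ-mono (λ i → 0≤ϑ _) τ≤Δθ (λ i → eψϑ≤ϑ′ (suc i))
  open Heights lem ℝ (IsUpperBoundedSource.isSource σ-bounded)
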